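{- Let $p$ be a prime and $n,k$ positive integers. The following are equivalent: (i) $S(n,k)$ is a minimum zero case, i.e. $\nu_p(S(n,k)) = (\sigma_p(k)-\sigma_p(n))/(p-1)$; (ii) $B_{n-k}^{(-k)}(x)$ has maximum pole, i.e. $\nu_p(B_{n-k}^{(-k)}) = -\sigma_p(n-k)/(p-1)$; (iii) $r=(n-k)/(p-1)$ is a nonnegative integer and $p \nmid \binom{ -(n+1)}{r}$, i.e. $p\nmid \binom{n+r}{r}$. Furthermore, in the minimum zero case, with $r=(n-k)/(p-1)$, \[ \epsilon_p(S(n,k)) \equiv (-1)^r\, \epsilon_p(n!/k!)\, \binom{n+r}{r} \pmod p. \]
   Context: $S(n,k)$ is the Stirling number of the second kind. $\nu_p$ is the $p$-adic valuation on $\mathbb{Q}$, $\sigma_p(m)$ the base-$p$ digit sum of $m\ge 0$, and for nonzero rational $x$, $\epsilon_p(x)=p^{ -\nu_p(x)}x$ is its unit part; congruences mod $p$ between $p$-adic units (rationals with numerator and denominator prime to $p$) mean their difference has positive $p$-adic valuation. For $m\in\mathbb{N}$ and $l\in\mathbb{Z}$, the higher order Bernoulli polynomials are defined by $\left(\frac{t}{e^t-1}\right)^l e^{tx}=\sum_{m\ge 0} B_m^{(l)}(x)\frac{t^m}{m!}$, and $B_m^{(l)}=B_m^{(l)}(0)$. -}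

module Defs where

open import Data.Nat as ℕ using (ℕ; zero; suc; _∸_; _!)
import Data.Nat.Properties as ℕP
open import Data.Nat.Divisibility using (_∣?_)
open import Data.Integer as ℤ using (ℤ; +_)
open import Data.Rational as ℚ using (ℚ; ↥_; ↧ₙ_)
open import Data.List using (List; upTo; map; foldr)
open import Data.Maybe using (Maybe; just; nothing)
open import Data.Unit using (⊤)
open import Relation.Nullary using (yes; no)

S : ℕ → ℕ → ℕ
S zero    zero    = 1
S zero    (suc k) = 0
S (suc n) zero    = 0
S (suc n) (suc k) = suc k ℕ.* S n (suc k) ℕ.+ S n k

ℕ→ℚ : ℕ → ℚ
ℕ→ℚ n = (+ n) ℚ./ 1

-- p-adic valuation of a natural number (meaningful for p ≥ 2, m ≥ 1):
-- the number of times p divides m. Computed with fuel (fuel m suffices).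

vℕ-fuel : ℕ → ℕ → ℕ → ℕ
vℕ-fuel zero    f       m = 0
vℕ-fuel (suc q) zero    m = 0
vℕ-fuel (suc q) (suc f) zero = 0
vℕ-fuel (suc q) (suc f) (suc m) with suc q ∣? suc m
... | yes _ = suc (vℕ-fuel (suc q) f (suc m ℕ./ suc q))
... | no  _ = 0

νℕ : ℕ → ℕ → ℕ
νℕ p m = vℕ-fuel p m m

-- p-adic valuation on ℚ, with values in ℤ ∪ {∞}; ∞ (the valuation of 0)
-- is represented by 'nothing'.
ν : ℕ → ℚ → Maybe ℤ
ν p x with ↥ x
... | + zero = nothing
... | a      = just ((+ νℕ p ℤ.∣ a ∣) ℤ.- (+ νℕ p (↧ₙ x)))

-- "ν_p(x) > 0" (true for x = 0, whose valuation is ∞)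
PosVal : Maybe ℤ → Set
PosVal nothing  = ⊤
PosVal (just v) = + 0 ℤ.< v

_≡[mod_]_ : ℚ → ℕ → ℚ → Set
x ≡[mod p ] y = PosVal (ν p (x ℚ.- y))

-- helper: 1 / p^v as a rational (junk 0 for p = 0)
invPow : ℕ → ℕ → ℚ
invPow zero    v = ℚ.0ℚ
invPow (suc q) v = (+ 1) ℚ./ (suc q ℕ.^ v)
  where instance _ = ℕP.m^n≢0 (suc q) v

-- unit part ε_p(x) = p^{-ν_p(x)} x  (ε_p(0) = 0).
-- With x = a/b, ν_p(x) = ν_p(a) - ν_p(b), so p^{-ν_p(x)} = p^{ν_p(b)} / p^{ν_p(a)}.
ε : ℕ → ℚ → ℚ
ε p x = x ℚ.* (ℕ→ℚ (p ℕ.^ νℕ p (↧ₙ x)) ℚ.* invPow p (νℕ p ℤ.∣ ↥ x ∣))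

-- base-p digit sum σ_p(m) (meaningful for p ≥ 2), computed with fuel.

σ-fuel : ℕ → ℕ → ℕ → ℕ
σ-fuel zero    f       m = 0
σ-fuel (suc q) zero    m = 0
σ-fuel (suc q) (suc f) m = m ℕ.% suc q ℕ.+ σ-fuel (suc q) f (m ℕ./ suc q)

σ : ℕ → ℕ → ℕ
σ p m = σ-fuel p m m

-- Higher order Bernoulli numbers of negative order -k:
-- (t/(e^t-1))^{-k} = ((e^t-1)/t)^k = Σ_m B_m^{(-k)} t^m / m!.
-- (e^t-1)/t = Σ_i t^i/(i+1)!.

ΣQ : List ℕ → (ℕ → ℚ) → ℚ
ΣQ is f = foldr (λ i acc → f i ℚ.+ acc) ℚ.0ℚ is

-- coefficient of t^i in (e^t-1)/t
Ecoef : ℕ → ℚ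
Ecoef i = (+ 1) ℚ./ (suc i !)
  where instance _ = ℕP._!≢0 (suc i)

-- coefficient of t^m in ((e^t-1)/t)^k  (Cauchy product)
powCoef : ℕ → ℕ → ℚ
powCoef zero    zero    = ℚ.1ℚ
powCoef zero    (suc m) = ℚ.0ℚ
powCoef (suc k) m       = ΣQ (upTo (suc m)) (λ i → Ecoef i ℚ.* powCoef k (m ∸ i))

-- B^{(-k)}_m = B^{(-k)}_m(0) = m! · [t^m] ((e^t-1)/t)^k
Bneg : ℕ → ℕ → ℚ
Bneg m k = ℕ→ℚ (m !) ℚ.* powCoef k m

factRatio : ℕ → ℕ → ℚ
factRatio n k = (+ (n !)) ℚ./ (k !)
  where instance _ = ℕP._!≢0 k

{-# OPTIONS --safe #-}

-- Write f = (eᵗ − 1)/t, m = n − k and a = [tᵐ] fᵏ, so that S(n,k) = (n!/k!) a and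
-- B_m^{(-k)} = m! a. By Legendre's formula (i) and (ii) both say that ν_p(a) = − m/(p − 1).
-- With y = eᵗ − 1, the identity t = log (1 + y) gives a recursion for the coefficients of
-- the powers of f whose only denominators are those of the logarithm. After scaling by
-- p^{⌊m/(p−1)⌋} all coefficients become p-integral, and modulo p only the terms y and yᵖ/p
-- of the logarithm survive. What is left is Pascal's recursion, whence
-- pʳ a ≡ (−1)ʳ binom(n + r, r) for m = (p − 1) r.
module Submission where

open import Defs
open import Data.Nat as ℕ using (ℕ; zero; suc; _≤_; _<_; _∸_; _!; NonZero; z≤n; s≤s)
import Data.Nat.Properties as ℕP
open import Data.Nat.Combinatorics using (_C_; nCk+nC[k+1]≡[n+1]C[k+1]; nCn≡1; nCk≡nC[n∸k])
open import Data.Nat.DivMod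
  using (m*n/n≡m; m/n<m; m≡m%n+[m/n]*n; m%n<n; [m+kn]%n≡m%n; m<n⇒m%n≡m; +-distrib-/-∣ʳ; m<n⇒m/n≡0)
open import Data.Nat.Divisibility
  using (_∣_; divides; _∣?_; m∣m*n; n∣m*n; ∣m⇒∣m*n; ∣m+n∣m⇒∣n; >⇒∤)
open import Data.Nat.Induction using (<-wellFounded)
open import Data.Nat.Primality using (Prime; euclidsLemma; prime⇒irreducible; ¬prime[0]; ¬prime[1])
open import Data.Nat.Tactic.RingSolver using (solve-∀)
open import Data.Integer as ℤ using (ℤ; +_; -[1+_]; ∣_∣)
import Data.Integer.Properties as ℤP
import Data.Integer.Tactic.RingSolver as ℤSolver
open import Data.Rational as ℚ using (ℚ; _+_; _*_; -_; 0ℚ; 1ℚ; ↥_; ↧_; ↧ₙ_; toℚᵘ)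
import Data.Rational.Properties as ℚP
open import Data.Rational.Solver using (module +-*-Solver)
import Data.Rational.Unnormalised as ℚᵘ
import Data.Rational.Unnormalised.Properties as ℚᵘP
open import Data.List using (applyUpTo)
open import Data.Maybe using (just)
open import Data.Maybe.Properties using (just-injective)
open import Data.Product using (Σ; ∃; _×_; _,_)
open import Data.Sum using (_⊎_; inj₁; inj₂; [_,_]′)
open import Data.Empty using (⊥; ⊥-elim)
open import Data.Unit using (tt)
open import Function.Bundles using (_⇔_; mk⇔)
open import Induction.WellFounded using (Acc; acc)
open import Relation.Nullary using (¬_; yes; no)
open import Relation.Binary.PropositionalEquality
open +-*-Solver

-- The embedding of ℤ into ℚ

-- The exponential recursion f^(k+1) = f · fᵏ is not suited to reduction modulo p. The coefficient
-- 1/(i+1)! of f has valuation at least -i/(p-1), but equality holds whenever i+1 is a power of p,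
-- so arbitrarily many terms would survive. The logarithm has denominators i+1, and ν_p(i+1) =
-- i/(p-1) happens only for i = 0 and i = p-1; this is Bernoulli's inequality with its cases of
-- equality. The price is that the recursion leads to higher powers of f, though in lower degree.
-- Claims are therefore made for all k at once, with the degree as the first induction variable. The
-- logarithm identity is obtained without composing series: y' = 1 + y gives a first-order recursion
-- for the coefficients of yᵏ, and the identity follows from it degree by degree. The edge k = 0
-- also fits Pascal's triangle: f⁰ = 1 has no coefficient in degree (p-1)(r+1), and p divides
-- binom(p(r+1), r+1). If p-1 does not divide m, an integer valuation cannot equal -m/(p-1), so
-- neither extremal case occurs.

ι : ℤ → ℚ
ι z = z ℚ./ 1

toℚᵘ-ι : ∀ z → toℚᵘ (ι z) ℚᵘ.≃ ℚᵘ.mkℚᵘ z 0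
toℚᵘ-ι z = ℚP.toℚᵘ-fromℚᵘ (ℚᵘ.mkℚᵘ z 0)

ι-+ : ∀ a b → ι (a ℤ.+ b) ≡ ι a + ι b
ι-+ a b = ℚP.toℚᵘ-injective (begin
  toℚᵘ (ι (a ℤ.+ b))                 ≈⟨ toℚᵘ-ι (a ℤ.+ b) ⟩
  ℚᵘ.mkℚᵘ (a ℤ.+ b) 0                 ≡⟨ cong₂ (λ x y → ℚᵘ.mkℚᵘ (x ℤ.+ y) 0) (ℤP.*-identityʳ a) (ℤP.*-identityʳ b) ⟨
  ℚᵘ.mkℚᵘ a 0 ℚᵘ.+ ℚᵘ.mkℚᵘ b 0        ≈⟨ ℚᵘP.+-cong (toℚᵘ-ι a) (toℚᵘ-ι b) ⟨
  toℚᵘ (ι a) ℚᵘ.+ toℚᵘ (ι b)          ≈⟨ ℚP.toℚᵘ-homo-+ (ι a) (ι b) ⟨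
  toℚᵘ (ι a + ι b)                    ∎)
  where open ℚᵘP.≃-Reasoning

ι-* : ∀ a b → ι (a ℤ.* b) ≡ ι a * ι b
ι-* a b = ℚP.toℚᵘ-injective (begin
  toℚᵘ (ι (a ℤ.* b))                 ≈⟨ toℚᵘ-ι (a ℤ.* b) ⟩
  ℚᵘ.mkℚᵘ a 0 ℚᵘ.* ℚᵘ.mkℚᵘ b 0        ≈⟨ ℚᵘP.*-cong (toℚᵘ-ι a) (toℚᵘ-ι b) ⟨
  toℚᵘ (ι a) ℚᵘ.* toℚᵘ (ι b)          ≈⟨ ℚP.toℚᵘ-homo-* (ι a) (ι b) ⟨
  toℚᵘ (ι a * ι b)                    ∎)
  where open ℚᵘP.≃-Reasoning

ι-neg : ∀ a → ι (ℤ.- a) ≡ - ι a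
ι-neg a = ℚP.toℚᵘ-injective (begin
  toℚᵘ (ι (ℤ.- a))         ≈⟨ toℚᵘ-ι (ℤ.- a) ⟩
  ℚᵘ.- ℚᵘ.mkℚᵘ a 0         ≈⟨ ℚᵘP.-‿cong (toℚᵘ-ι a) ⟨
  ℚᵘ.- toℚᵘ (ι a)          ≈⟨ ℚP.toℚᵘ-homo‿- (ι a) ⟨
  toℚᵘ (- ι a)             ∎)
  where open ℚᵘP.≃-Reasoning

ι-injective : ∀ {a b} → ι a ≡ ι b → a ≡ b
ι-injective {a} {b} eq = begin
  a           ≡⟨ ℤP.*-identityʳ a ⟨
  a ℤ.* + 1   ≡⟨ ℚᵘP.drop-*≡* (ℚᵘP.≃-trans (ℚᵘP.≃-sym (toℚᵘ-ι a)) (ℚᵘP.≃-trans (ℚP.toℚᵘ-cong eq) (toℚᵘ-ι b))) ⟩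
  b ℤ.* + 1   ≡⟨ ℤP.*-identityʳ b ⟩
  b           ∎
  where open ≡-Reasoning

ℕ→ℚ-+ : ∀ m n → ℕ→ℚ (m ℕ.+ n) ≡ ℕ→ℚ m + ℕ→ℚ n
ℕ→ℚ-+ m n = ι-+ (+ m) (+ n)

ℕ→ℚ-* : ∀ m n → ℕ→ℚ (m ℕ.* n) ≡ ℕ→ℚ m * ℕ→ℚ n
ℕ→ℚ-* m n = trans (cong ι (ℤP.pos-* m n)) (ι-* (+ m) (+ n))

/-*-cancel : ∀ z d .{{_ : NonZero d}} → (z ℚ./ d) * ℕ→ℚ d ≡ ι z
/-*-cancel z (suc d) = ℚP.toℚᵘ-injective (begin
  toℚᵘ ((z ℚ./ suc d) * ι (+ suc d))                 ≈⟨ ℚP.toℚᵘ-homo-* (z ℚ./ suc d) (ι (+ suc d)) ⟩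
  toℚᵘ (z ℚ./ suc d) ℚᵘ.* toℚᵘ (ι (+ suc d))          ≈⟨ ℚᵘP.*-cong (ℚP.toℚᵘ-fromℚᵘ (ℚᵘ.mkℚᵘ z d)) (toℚᵘ-ι (+ suc d)) ⟩
  ℚᵘ.mkℚᵘ z d ℚᵘ.* ℚᵘ.mkℚᵘ (+ suc d) 0                ≈⟨ ℚᵘ.*≡* (trans (ℤP.*-identityʳ _) (cong (λ e → z ℤ.* + e) (sym (ℕP.*-identityʳ (suc d))))) ⟩
  ℚᵘ.mkℚᵘ z 0                                         ≈⟨ toℚᵘ-ι z ⟨
  toℚᵘ (ι z)                                          ∎)
  where open ℚᵘP.≃-Reasoning

*-cancelˡ : ∀ d .{{_ : NonZero d}} {x y} → ℕ→ℚ d * x ≡ ℕ→ℚ d * y → x ≡ y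
*-cancelˡ d {x} {y} eq = begin
  x                          ≡⟨ drop x ⟨
  (+ 1 ℚ./ d) * (ℕ→ℚ d * x)  ≡⟨ cong ((+ 1 ℚ./ d) *_) eq ⟩
  (+ 1 ℚ./ d) * (ℕ→ℚ d * y)  ≡⟨ drop y ⟩
  y                          ∎
  where
  open ≡-Reasoning
  drop : ∀ w → (+ 1 ℚ./ d) * (ℕ→ℚ d * w) ≡ w
  drop w = begin
    (+ 1 ℚ./ d) * (ℕ→ℚ d * w)  ≡⟨ ℚP.*-assoc (+ 1 ℚ./ d) (ℕ→ℚ d) w ⟨
    (+ 1 ℚ./ d) * ℕ→ℚ d * w    ≡⟨ cong (_* w) (/-*-cancel (+ 1) d) ⟩
    1ℚ * w                     ≡⟨ ℚP.*-identityˡ w ⟩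
    w                          ∎

+-congˡ : ∀ x {y z} → y ≡ z → x + y ≡ x + z
+-congˡ x refl = refl

-- Cauchy products and the powers of (eᵗ − 1)/t

-- Both indices of a convolution are arguments, so that `i + j ≡ m` is available as an equation and
-- no truncated subtraction enters the later algebra.
diag : (ℕ → ℕ → ℚ) → ℕ → ℚ
diag h zero    = h 0 0
diag h (suc m) = h 0 (suc m) + diag (λ i → h (suc i)) m

diag-cong : ∀ {h g} m → (∀ i j → i ℕ.+ j ≡ m → h i j ≡ g i j) → diag h m ≡ diag g m
diag-cong zero    eq = eq 0 0 refl
diag-cong (suc m) eq = cong₂ _+_ (eq 0 (suc m) refl) (diag-cong m (λ i j e → eq (suc i) j (cong suc e)))

diag-+ : ∀ h g m → diag (λ i j → h i j + g i j) m ≡ diag h m + diag g m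
diag-+ h g zero    = refl
diag-+ h g (suc m) = trans (+-congˡ (h 0 (suc m) + g 0 (suc m)) (diag-+ (λ i → h (suc i)) (λ i → g (suc i)) m))
  (solve 4 (λ a b c d → a :+ b :+ (c :+ d) := a :+ c :+ (b :+ d)) refl
    (h 0 (suc m)) (g 0 (suc m)) (diag (λ i → h (suc i)) m) (diag (λ i → g (suc i)) m))

diag-* : ∀ c h m → diag (λ i j → c * h i j) m ≡ c * diag h m
diag-* c h zero    = refl
diag-* c h (suc m) = trans (+-congˡ (c * h 0 (suc m)) (diag-* c (λ i → h (suc i)) m))
  (sym (ℚP.*-distribˡ-+ c (h 0 (suc m)) (diag (λ i → h (suc i)) m)))

diag-0 : ∀ (h : ℕ → ℕ → ℚ) m → diag (λ i j → 0ℚ * h i j) m ≡ 0ℚ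
diag-0 h m = trans (diag-* 0ℚ h m) (ℚP.*-zeroˡ (diag h m))

-- Multiplication of a power series by t.
shift : (ℕ → ℚ) → ℕ → ℚ
shift f zero    = 0ℚ
shift f (suc m) = f m

shift-* : ∀ c f m → c * shift f m ≡ shift (λ j → c * f j) m
shift-* c f zero    = ℚP.*-zeroʳ c
shift-* c f (suc m) = refl

diag-shift : ∀ h m → diag (λ i → shift (h i)) m ≡ shift (diag h) m
diag-shift h zero          = refl
diag-shift h (suc zero)    = ℚP.+-identityʳ (h 0 0)
diag-shift h (suc (suc m)) = +-congˡ (h 0 (suc m)) (diag-shift (λ i → h (suc i)) (suc m))

diag-shiftˡ : ∀ (f g : ℕ → ℚ) m → diag (λ i j → shift f i * g j) m ≡ shift (diag (λ i j → f i * g j)) m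
diag-shiftˡ f g zero    = ℚP.*-zeroˡ (g 0)
diag-shiftˡ f g (suc m) = trans (cong (_+ diag (λ i j → f i * g j) m) (ℚP.*-zeroˡ (g (suc m)))) (ℚP.+-identityˡ _)

diag-shiftʳ : ∀ (f : ℕ → ℚ) (g : ℕ → ℕ → ℚ) m →
  diag (λ i j → f i * shift (g i) j) m ≡ shift (diag (λ i j → f i * g i j)) m
diag-shiftʳ f g m = trans (diag-cong m (λ i j _ → shift-* (f i) (g i) j)) (diag-shift (λ i j → f i * g i j) m)

diag-δ : ∀ (g : ℕ → ℚ) m → diag (λ i j → powCoef 0 i * g j) m ≡ g m
diag-δ g zero    = ℚP.*-identityˡ (g 0)
diag-δ g (suc m) = trans (cong₂ _+_ (ℚP.*-identityˡ (g (suc m))) (diag-0 (λ _ j → g j) m)) (ℚP.+-identityʳ _)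

ΣQ-applyUpTo : ∀ m (f : ℕ → ℕ) F h → (∀ i → F (f i) ≡ h i (m ∸ i)) → ΣQ (applyUpTo f (suc m)) F ≡ diag h m
ΣQ-applyUpTo zero    f F h eq = trans (ℚP.+-identityʳ _) (eq 0)
ΣQ-applyUpTo (suc m) f F h eq =
  cong₂ _+_ (eq 0) (ΣQ-applyUpTo m (λ i → f (suc i)) F (λ i → h (suc i)) (λ i → eq (suc i)))

powCoef-suc : ∀ k m → powCoef (suc k) m ≡ diag (λ i j → Ecoef i * powCoef k j) m
powCoef-suc k m = ΣQ-applyUpTo m (λ i → i) _ _ (λ i → refl)

-- Coefficients in (t f)' = t f + 1, where t f = eᵗ - 1; the sequence `powCoef 0` is the constant
-- series 1.
Ecoef-rec : ∀ i → ℕ→ℚ (suc i) * Ecoef i ≡ shift Ecoef i + powCoef 0 i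
Ecoef-rec zero    = refl
Ecoef-rec (suc i) = *-cancelˡ (suc i !) (begin
  ℕ→ℚ (suc i !) * (ℕ→ℚ (suc (suc i)) * Ecoef (suc i))  ≡⟨ solve 3 (λ a b c → a :* (b :* c) := c :* (b :* a)) refl (ℕ→ℚ (suc i !)) (ℕ→ℚ (suc (suc i))) (Ecoef (suc i)) ⟩
  Ecoef (suc i) * (ℕ→ℚ (suc (suc i)) * ℕ→ℚ (suc i !))  ≡⟨ cong (Ecoef (suc i) *_) (ℕ→ℚ-* (suc (suc i)) (suc i !)) ⟨
  Ecoef (suc i) * ℕ→ℚ (suc (suc i) !)                  ≡⟨ /-*-cancel (+ 1) (suc (suc i) !) ⟩
  1ℚ                                                   ≡⟨ /-*-cancel (+ 1) (suc i !) ⟨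
  Ecoef i * ℕ→ℚ (suc i !)                              ≡⟨ solve 2 (λ a b → a :* b := b :* (a :+ con 0ℚ)) refl (Ecoef i) (ℕ→ℚ (suc i !)) ⟩
  ℕ→ℚ (suc i !) * (Ecoef i + 0ℚ)                       ∎)
  where
  open ≡-Reasoning
  instance
    _ = ℕP._!≢0 (suc i)
    _ = ℕP._!≢0 (suc (suc i))

-- With y = t f and y' = 1 + y, these are the coefficients in (yᵏ)' = k (yᵏ + y^(k-1)). The
-- induction on k is the product rule. At k = 0 the value of `ℕ.pred` does not matter, because the
-- factor k vanishes.
powCoef-rec : ∀ k m → ℕ→ℚ (m ℕ.+ k) * powCoef k m ≡ ℕ→ℚ k * (shift (powCoef k) m + powCoef (ℕ.pred k) m)
powCoef-rec zero    zero    = refl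
powCoef-rec zero    (suc m) = trans (ℚP.*-zeroʳ (ℕ→ℚ (suc m ℕ.+ 0))) (sym (ℚP.*-zeroˡ (powCoef 0 m + powCoef 0 (suc m))))
powCoef-rec (suc k) m = begin
  ℕ→ℚ (m ℕ.+ suc k) * powCoef (suc k) m
    ≡⟨ cong (ℕ→ℚ (m ℕ.+ suc k) *_) (powCoef-suc k m) ⟩
  ℕ→ℚ (m ℕ.+ suc k) * diag (λ i j → E i * a j) m
    ≡⟨ diag-* (ℕ→ℚ (m ℕ.+ suc k)) (λ i j → E i * a j) m ⟨
  diag (λ i j → ℕ→ℚ (m ℕ.+ suc k) * (E i * a j)) m
    ≡⟨ diag-cong m leibniz ⟩
  diag (λ i j → (shift E i * a j + powCoef 0 i * a j) + ℕ→ℚ k * (E i * shift a j + E i * a′ j)) m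
    ≡⟨ diag-+ (λ i j → shift E i * a j + powCoef 0 i * a j) (λ i j → ℕ→ℚ k * (E i * shift a j + E i * a′ j)) m ⟩
  diag (λ i j → shift E i * a j + powCoef 0 i * a j) m + diag (λ i j → ℕ→ℚ k * (E i * shift a j + E i * a′ j)) m
    ≡⟨ cong₂ _+_ (diag-+ (λ i j → shift E i * a j) (λ i j → powCoef 0 i * a j) m)
         (trans (diag-* (ℕ→ℚ k) (λ i j → E i * shift a j + E i * a′ j) m)
                (cong (ℕ→ℚ k *_) (diag-+ (λ i j → E i * shift a j) (λ i j → E i * a′ j) m))) ⟩
  (diag (λ i j → shift E i * a j) m + diag (λ i j → powCoef 0 i * a j) m)
    + ℕ→ℚ k * (diag (λ i j → E i * shift a j) m + diag (λ i j → E i * a′ j) m)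
    ≡⟨ cong₂ _+_ (cong₂ _+_ (trans (diag-shiftˡ E a m) (unfold m)) (diag-δ a m))
         (trans (ℚP.*-distribˡ-+ (ℕ→ℚ k) _ _)
                (cong₂ _+_ (cong (ℕ→ℚ k *_) (trans (diag-shiftʳ E (λ _ → a) m) (unfold m))) (lower k))) ⟩
  (s + a m) + (ℕ→ℚ k * s + ℕ→ℚ k * a m)
    ≡⟨ solve 3 (λ s a k → (s :+ a) :+ (k :* s :+ k :* a) := (con 1ℚ :+ k) :* (s :+ a)) refl s (a m) (ℕ→ℚ k) ⟩
  (1ℚ + ℕ→ℚ k) * (s + a m)
    ≡⟨ cong (_* (s + a m)) (ℕ→ℚ-+ 1 k) ⟨
  ℕ→ℚ (suc k) * (s + a m) ∎
  where
  open ≡-Reasoning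
  E = Ecoef
  a = powCoef k
  a′ = powCoef (ℕ.pred k)
  s = shift (powCoef (suc k)) m
  unfold : ∀ m → shift (diag (λ i j → E i * a j)) m ≡ shift (powCoef (suc k)) m
  unfold zero    = refl
  unfold (suc m) = sym (powCoef-suc k m)
  lower : ∀ k → ℕ→ℚ k * diag (λ i j → E i * powCoef (ℕ.pred k) j) m ≡ ℕ→ℚ k * powCoef k m
  lower zero    = trans (ℚP.*-zeroˡ (diag (λ i j → E i * powCoef 0 j) m)) (sym (ℚP.*-zeroˡ (powCoef 0 m)))
  lower (suc k) = cong (ℕ→ℚ (suc k) *_) (sym (powCoef-suc k m))
  leibniz : ∀ i j → i ℕ.+ j ≡ m → ℕ→ℚ (m ℕ.+ suc k) * (E i * a j)
    ≡ (shift E i * a j + powCoef 0 i * a j) + ℕ→ℚ k * (E i * shift a j + E i * a′ j)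
  leibniz i j refl = begin
    ℕ→ℚ (i ℕ.+ j ℕ.+ suc k) * (E i * a j)
      ≡⟨ cong (λ n → ℕ→ℚ n * (E i * a j)) (trans (ℕP.+-suc (i ℕ.+ j) k) (cong suc (ℕP.+-assoc i j k))) ⟩
    ℕ→ℚ (suc i ℕ.+ (j ℕ.+ k)) * (E i * a j)
      ≡⟨ cong (_* (E i * a j)) (ℕ→ℚ-+ (suc i) (j ℕ.+ k)) ⟩
    (ℕ→ℚ (suc i) + ℕ→ℚ (j ℕ.+ k)) * (E i * a j)
      ≡⟨ solve 4 (λ u v e a → (u :+ v) :* (e :* a) := (u :* e) :* a :+ e :* (v :* a)) refl (ℕ→ℚ (suc i)) (ℕ→ℚ (j ℕ.+ k)) (E i) (a j) ⟩
    (ℕ→ℚ (suc i) * E i) * a j + E i * (ℕ→ℚ (j ℕ.+ k) * a j)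
      ≡⟨ cong₂ (λ x y → x * a j + E i * y) (Ecoef-rec i) (powCoef-rec k j) ⟩
    (shift E i + powCoef 0 i) * a j + E i * (ℕ→ℚ k * (shift a j + a′ j))
      ≡⟨ solve 7 (λ x y a e k u v → (x :+ y) :* a :+ e :* (k :* (u :+ v)) := (x :* a :+ y :* a) :+ k :* (e :* u :+ e :* v)) refl
           (shift E i) (powCoef 0 i) (a j) (E i) (ℕ→ℚ k) (shift a j) (a′ j) ⟩
    (shift E i * a j + powCoef 0 i * a j) + ℕ→ℚ k * (E i * shift a j + E i * a′ j) ∎

-- The logarithm recursion for the powers of f

sgn : ℕ → ℚ
sgn r = ι ((ℤ.- (+ 1)) ℤ.^ r)

sgn-suc : ∀ r → sgn (suc r) ≡ - sgn r
sgn-suc r = trans (ι-* (ℤ.- (+ 1)) ((ℤ.- (+ 1)) ℤ.^ r))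
  (trans (sym (ℚP.neg-distribˡ-* 1ℚ (sgn r))) (cong -_ (ℚP.*-identityˡ (sgn r))))

-- The coefficient of y^(i+1) in log (1 + y); the index is lowered by one because the series starts
-- with y.
logCoef : ℕ → ℚ
logCoef i = sgn i * (+ 1 ℚ./ suc i)

logCoef-* : ∀ i → logCoef i * ℕ→ℚ (suc i) ≡ sgn i
logCoef-* i = trans (ℚP.*-assoc (sgn i) (+ 1 ℚ./ suc i) (ℕ→ℚ (suc i)))
  (trans (cong (sgn i *_) (/-*-cancel (+ 1) (suc i))) (ℚP.*-identityʳ (sgn i)))

-- The shifted half of term i cancels the unshifted half of term i + 1, and the last shift is taken
-- in degree 0, where it is 0. For g i the coefficients of y^(i+k) this is (1 + y) · 1/(1 + y) = 1.
telescope : ∀ (g : ℕ → ℕ → ℚ) m → diag (λ i j → sgn i * (shift (g (suc i)) j + g i j)) m ≡ g 0 m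
telescope g zero    = trans (ℚP.*-identityˡ _) (ℚP.+-identityˡ (g 0 0))
telescope g (suc m) = begin
  1ℚ * (g 1 m + g 0 (suc m)) + diag (λ i j → sgn (suc i) * (shift (g (2 ℕ.+ i)) j + g (suc i) j)) m
    ≡⟨ +-congˡ (1ℚ * (g 1 m + g 0 (suc m))) (trans (diag-cong m negate)
         (trans (diag-* (- 1ℚ) (λ i j → sgn i * (shift (g (2 ℕ.+ i)) j + g (suc i) j)) m)
                (cong (- 1ℚ *_) (telescope (λ i → g (suc i)) m)))) ⟩
  1ℚ * (g 1 m + g 0 (suc m)) + - 1ℚ * g 1 m
    ≡⟨ solve 2 (λ x y → con 1ℚ :* (x :+ y) :+ (:- con 1ℚ) :* x := y) refl (g 1 m) (g 0 (suc m)) ⟩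
  g 0 (suc m) ∎
  where
  open ≡-Reasoning
  negate : ∀ i j → i ℕ.+ j ≡ m → sgn (suc i) * (shift (g (2 ℕ.+ i)) j + g (suc i) j)
    ≡ - 1ℚ * (sgn i * (shift (g (2 ℕ.+ i)) j + g (suc i) j))
  negate i j _ = trans (cong (_* (shift (g (2 ℕ.+ i)) j + g (suc i) j)) (sgn-suc i))
    (solve 2 (λ s x → (:- s) :* x := (:- con 1ℚ) :* (s :* x)) refl (sgn i) (shift (g (2 ℕ.+ i)) j + g (suc i) j))

-- With y = eᵗ − 1 and f = y/t, the coefficient of tᵐ in fᵏ · (log (1 + y))/t = fᵏ.
mutual
  powCoef-log : ∀ m k → diag (λ i j → logCoef i * powCoef (suc (i ℕ.+ k)) j) m ≡ powCoef k m
  powCoef-log m k = *-cancelˡ (suc (m ℕ.+ k)) (begin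
    -- The factor m + k + 1 is the degree in t of the coefficient taken from yᵏ log (1 + y), so
    -- multiplying by it differentiates. The derivative of the logarithm contributes yᵏ through
    -- `telescope`; the derivative of yᵏ contributes k times the identity itself at (m - 1, k) and
    -- (m, k - 1).
    N * diag (λ i j → logCoef i * a (suc (i ℕ.+ k)) j) m
      ≡⟨ diag-* N (λ i j → logCoef i * a (suc (i ℕ.+ k)) j) m ⟨
    diag (λ i j → N * (logCoef i * a (suc (i ℕ.+ k)) j)) m
      ≡⟨ diag-cong m expand ⟩
    diag (λ i j → u i j + ℕ→ℚ k * (v i j + w i j)) m
      ≡⟨ diag-+ u (λ i j → ℕ→ℚ k * (v i j + w i j)) m ⟩
    diag u m + diag (λ i j → ℕ→ℚ k * (v i j + w i j)) m
      ≡⟨ cong₂ _+_ (telescope (λ i → a (i ℕ.+ k)) m)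
           (trans (diag-* (ℕ→ℚ k) (λ i j → v i j + w i j) m) (cong (ℕ→ℚ k *_) (diag-+ v w m))) ⟩
    a k m + ℕ→ℚ k * (diag v m + diag w m)
      ≡⟨ +-congˡ (a k m) (trans (ℚP.*-distribˡ-+ (ℕ→ℚ k) (diag v m) (diag w m))
           (trans (cong₂ _+_ (cong (ℕ→ℚ k *_) (trans (diag-shiftʳ logCoef (λ i → a (suc (i ℕ.+ k))) m) (powCoef-log-shift m k))) (powCoef-log-pred m k))
             (sym (ℚP.*-distribˡ-+ (ℕ→ℚ k) (shift (a k) m) (a (ℕ.pred k) m))))) ⟩
    a k m + ℕ→ℚ k * (shift (a k) m + a (ℕ.pred k) m)
      ≡⟨ +-congˡ (a k m) (powCoef-rec k m) ⟨
    a k m + ℕ→ℚ (m ℕ.+ k) * a k m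
      ≡⟨ solve 2 (λ x n → x :+ n :* x := (con 1ℚ :+ n) :* x) refl (a k m) (ℕ→ℚ (m ℕ.+ k)) ⟩
    (1ℚ + ℕ→ℚ (m ℕ.+ k)) * a k m
      ≡⟨ cong (_* a k m) (ℕ→ℚ-+ 1 (m ℕ.+ k)) ⟨
    N * a k m ∎)
    where
    open ≡-Reasoning
    a = powCoef
    N = ℕ→ℚ (suc (m ℕ.+ k))
    u v w : ℕ → ℕ → ℚ
    u i j = sgn i * (shift (a (suc i ℕ.+ k)) j + a (i ℕ.+ k) j)
    v i j = logCoef i * shift (a (suc (i ℕ.+ k))) j
    w i j = logCoef i * a (i ℕ.+ k) j
    expand : ∀ i j → i ℕ.+ j ≡ m → N * (logCoef i * a (suc (i ℕ.+ k)) j) ≡ u i j + ℕ→ℚ k * (v i j + w i j)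
    expand i j refl = begin
      ℕ→ℚ (suc (i ℕ.+ j ℕ.+ k)) * (logCoef i * a (suc (i ℕ.+ k)) j)
        ≡⟨ cong (λ n → ℕ→ℚ n * (logCoef i * a (suc (i ℕ.+ k)) j))
             (trans (cong (λ n → suc (n ℕ.+ k)) (ℕP.+-comm i j)) (trans (cong suc (ℕP.+-assoc j i k)) (sym (ℕP.+-suc j (i ℕ.+ k))))) ⟩
      ℕ→ℚ (j ℕ.+ suc (i ℕ.+ k)) * (logCoef i * a (suc (i ℕ.+ k)) j)
        ≡⟨ solve 3 (λ x y z → x :* (y :* z) := y :* (x :* z)) refl (ℕ→ℚ (j ℕ.+ suc (i ℕ.+ k))) (logCoef i) (a (suc (i ℕ.+ k)) j) ⟩
      logCoef i * (ℕ→ℚ (j ℕ.+ suc (i ℕ.+ k)) * a (suc (i ℕ.+ k)) j)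
        ≡⟨ cong (logCoef i *_) (powCoef-rec (suc (i ℕ.+ k)) j) ⟩
      logCoef i * (ℕ→ℚ (suc i ℕ.+ k) * (x + y))
        ≡⟨ cong (λ n → logCoef i * (n * (x + y))) (ℕ→ℚ-+ (suc i) k) ⟩
      logCoef i * ((ℕ→ℚ (suc i) + ℕ→ℚ k) * (x + y))
        ≡⟨ solve 5 (λ c n k x y → c :* ((n :+ k) :* (x :+ y)) := (c :* n) :* (x :+ y) :+ k :* (c :* x :+ c :* y)) refl
             (logCoef i) (ℕ→ℚ (suc i)) (ℕ→ℚ k) x y ⟩
      (logCoef i * ℕ→ℚ (suc i)) * (x + y) + ℕ→ℚ k * (v i j + w i j)
        ≡⟨ cong (λ n → n * (x + y) + ℕ→ℚ k * (v i j + w i j)) (logCoef-* i) ⟩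
      u i j + ℕ→ℚ k * (v i j + w i j) ∎
      where
      x = shift (a (suc i ℕ.+ k)) j
      y = a (i ℕ.+ k) j

  powCoef-log-shift : ∀ m k → shift (diag (λ i j → logCoef i * powCoef (suc (i ℕ.+ k)) j)) m ≡ shift (powCoef k) m
  powCoef-log-shift zero    k = refl
  powCoef-log-shift (suc m) k = powCoef-log m k

  powCoef-log-pred : ∀ m k →
    ℕ→ℚ k * diag (λ i j → logCoef i * powCoef (i ℕ.+ k) j) m ≡ ℕ→ℚ k * powCoef (ℕ.pred k) m
  powCoef-log-pred m zero    = trans (ℚP.*-zeroˡ (diag (λ i j → logCoef i * powCoef (i ℕ.+ 0) j) m)) (sym (ℚP.*-zeroˡ (powCoef 0 m)))
  powCoef-log-pred m (suc k) = cong (ℕ→ℚ (suc k) *_)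
    (trans (diag-cong m (λ i j _ → cong (λ l → logCoef i * powCoef l j) (ℕP.+-suc i k))) (powCoef-log m k))

-- Stirling numbers as coefficients

n<k⇒S≡0 : ∀ n k → n ℕ.< k → S n k ≡ 0
n<k⇒S≡0 zero    (suc k) _           = refl
n<k⇒S≡0 (suc n) (suc k) (ℕ.s≤s n<k) = begin
  suc k ℕ.* S n (suc k) ℕ.+ S n k  ≡⟨ cong₂ (λ x y → suc k ℕ.* x ℕ.+ y) (n<k⇒S≡0 n (suc k) (ℕP.m<n⇒m<1+n n<k)) (n<k⇒S≡0 n k n<k) ⟩
  suc k ℕ.* 0 ℕ.+ 0                ≡⟨ trans (ℕP.+-identityʳ _) (ℕP.*-zeroʳ (suc k)) ⟩
  0                                ∎
  where open ≡-Reasoning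

-- yᵏ/k! is the exponential generating function of the numbers S(n,k). After multiplication by the
-- factorials, the recursion defining `S` becomes `powCoef-rec`.
k!S≡n!powCoef : ∀ k m → ℕ→ℚ (k !) * ℕ→ℚ (S (k ℕ.+ m) k) ≡ ℕ→ℚ ((k ℕ.+ m) !) * powCoef k m
k!S≡n!powCoef zero    zero    = refl
k!S≡n!powCoef zero    (suc m) = trans (ℚP.*-zeroʳ 1ℚ) (sym (ℚP.*-zeroʳ (ℕ→ℚ (suc m !))))
k!S≡n!powCoef (suc k) m = begin
  ℕ→ℚ (suc k !) * ℕ→ℚ (suc k ℕ.* S (k ℕ.+ m) (suc k) ℕ.+ S (k ℕ.+ m) k)
    ≡⟨ cong₂ _*_ (ℕ→ℚ-* (suc k) (k !)) (trans (ℕ→ℚ-+ (suc k ℕ.* S (k ℕ.+ m) (suc k)) _) (cong (_+ t) (ℕ→ℚ-* (suc k) (S (k ℕ.+ m) (suc k))))) ⟩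
  (K * F) * (K * ℕ→ℚ (S (k ℕ.+ m) (suc k)) + t)
    ≡⟨ solve 4 (λ K F s t → (K :* F) :* (K :* s :+ t) := K :* ((K :* F) :* s :+ F :* t)) refl K F (ℕ→ℚ (S (k ℕ.+ m) (suc k))) t ⟩
  K * ((K * F) * ℕ→ℚ (S (k ℕ.+ m) (suc k)) + F * t)
    ≡⟨ cong₂ (λ x y → K * (x + y)) (trans (cong (_* ℕ→ℚ (S (k ℕ.+ m) (suc k))) (sym (ℕ→ℚ-* (suc k) (k !)))) (upper m)) (k!S≡n!powCoef k m) ⟩
  K * (G * shift (powCoef (suc k)) m + G * powCoef k m)
    ≡⟨ solve 4 (λ K G x y → K :* (G :* x :+ G :* y) := G :* (K :* (x :+ y))) refl K G (shift (powCoef (suc k)) m) (powCoef k m) ⟩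
  G * (K * (shift (powCoef (suc k)) m + powCoef k m))
    ≡⟨ cong (G *_) (powCoef-rec (suc k) m) ⟨
  G * (ℕ→ℚ (m ℕ.+ suc k) * powCoef (suc k) m)
    ≡⟨ solve 3 (λ G n x → G :* (n :* x) := (n :* G) :* x) refl G (ℕ→ℚ (m ℕ.+ suc k)) (powCoef (suc k) m) ⟩
  (ℕ→ℚ (m ℕ.+ suc k) * G) * powCoef (suc k) m
    ≡⟨ cong (λ n → (ℕ→ℚ n * G) * powCoef (suc k) m) (ℕP.+-comm m (suc k)) ⟩
  (ℕ→ℚ (suc (k ℕ.+ m)) * G) * powCoef (suc k) m
    ≡⟨ cong (_* powCoef (suc k) m) (ℕ→ℚ-* (suc (k ℕ.+ m)) ((k ℕ.+ m) !)) ⟨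
  ℕ→ℚ ((suc k ℕ.+ m) !) * powCoef (suc k) m ∎
  where
  open ≡-Reasoning
  K = ℕ→ℚ (suc k)
  F = ℕ→ℚ (k !)
  G = ℕ→ℚ ((k ℕ.+ m) !)
  t = ℕ→ℚ (S (k ℕ.+ m) k)
  upper : ∀ m → ℕ→ℚ (suc k !) * ℕ→ℚ (S (k ℕ.+ m) (suc k)) ≡ ℕ→ℚ ((k ℕ.+ m) !) * shift (powCoef (suc k)) m
  upper zero    = trans (cong (λ n → ℕ→ℚ (suc k !) * ℕ→ℚ n) (n<k⇒S≡0 (k ℕ.+ 0) (suc k) (ℕ.s≤s (ℕP.≤-reflexive (ℕP.+-identityʳ k)))))
    (trans (ℚP.*-zeroʳ (ℕ→ℚ (suc k !))) (sym (ℚP.*-zeroʳ (ℕ→ℚ ((k ℕ.+ 0) !)))))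
  upper (suc m) = subst (λ n → ℕ→ℚ (suc k !) * ℕ→ℚ (S n (suc k)) ≡ ℕ→ℚ (n !) * powCoef (suc k) m) (sym (ℕP.+-suc k m)) (k!S≡n!powCoef (suc k) m)

-- Binomial coefficients and elementary inequalities

nC0≡1 : ∀ n → n C 0 ≡ 1
nC0≡1 n = trans (nCk≡nC[n∸k] {0} {n} z≤n) (nCn≡1 n)

[k+1]*[n+1]C[k+1]≡[n+1]*nCk : ∀ n k → suc k ℕ.* (suc n C suc k) ≡ suc n ℕ.* (n C k)
[k+1]*[n+1]C[k+1]≡[n+1]*nCk zero    zero    = refl
[k+1]*[n+1]C[k+1]≡[n+1]*nCk zero    (suc k) = ℕP.*-zeroʳ (2 ℕ.+ k)
[k+1]*[n+1]C[k+1]≡[n+1]*nCk (suc n) zero    = begin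
  1 ℕ.* (suc (suc n) C 1)                    ≡⟨ cong (1 ℕ.*_) (nCk+nC[k+1]≡[n+1]C[k+1] (suc n) 0) ⟨
  1 ℕ.* ((suc n C 0) ℕ.+ (suc n C 1))    ≡⟨ ℕP.*-distribˡ-+ 1 (suc n C 0) (suc n C 1) ⟩
  1 ℕ.* (suc n C 0) ℕ.+ 1 ℕ.* (suc n C 1) ≡⟨ cong (1 ℕ.* (suc n C 0) ℕ.+_) ([k+1]*[n+1]C[k+1]≡[n+1]*nCk n 0) ⟩
  1 ℕ.* (suc n C 0) ℕ.+ suc n ℕ.* (n C 0) ≡⟨ cong₂ (λ x y → 1 ℕ.* x ℕ.+ suc n ℕ.* y) (nC0≡1 (suc n)) (nC0≡1 n) ⟩
  1 ℕ.+ suc n ℕ.* 1                      ≡⟨ cong ((2 ℕ.+ n) ℕ.*_) (nC0≡1 (suc n)) ⟨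
  (2 ℕ.+ n) ℕ.* (suc n C 0)              ∎
  where open ≡-Reasoning
[k+1]*[n+1]C[k+1]≡[n+1]*nCk (suc n) (suc k) = begin
  (2 ℕ.+ k) ℕ.* (suc (suc n) C suc (suc k))
    ≡⟨ cong ((2 ℕ.+ k) ℕ.*_) (nCk+nC[k+1]≡[n+1]C[k+1] (suc n) (suc k)) ⟨
  (2 ℕ.+ k) ℕ.* ((suc n C suc k) ℕ.+ (suc n C suc (suc k)))
    ≡⟨ expand k (suc n C suc k) (suc n C suc (suc k)) ⟩
  (suc n C suc k) ℕ.+ (suc k ℕ.* (suc n C suc k) ℕ.+ (2 ℕ.+ k) ℕ.* (suc n C suc (suc k)))
    ≡⟨ cong₂ (λ x y → (suc n C suc k) ℕ.+ (x ℕ.+ y)) ([k+1]*[n+1]C[k+1]≡[n+1]*nCk n k) ([k+1]*[n+1]C[k+1]≡[n+1]*nCk n (suc k)) ⟩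
  (suc n C suc k) ℕ.+ (suc n ℕ.* (n C k) ℕ.+ suc n ℕ.* (n C suc k))
    ≡⟨ cong ((suc n C suc k) ℕ.+_) (trans (sym (ℕP.*-distribˡ-+ (suc n) (n C k) (n C suc k))) (cong (suc n ℕ.*_) (nCk+nC[k+1]≡[n+1]C[k+1] n k))) ⟩
  (2 ℕ.+ n) ℕ.* (suc n C suc k) ∎
  where
  open ≡-Reasoning
  expand : ∀ k x y → (2 ℕ.+ k) ℕ.* (x ℕ.+ y) ≡ x ℕ.+ (suc k ℕ.* x ℕ.+ (2 ℕ.+ k) ℕ.* y)
  expand = solve-∀

-- Absorption gives the cofactor binom(p(r+1) - 1, r). This is the edge k = 0 of the Pascal
-- recursion modulo p.
p∣p[r+1]C[r+1] : ∀ p r → p ∣ ((p ℕ.* suc r) C suc r)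
p∣p[r+1]C[r+1] zero    r = divides 0 (sym (ℕP.*-zeroʳ 0))
p∣p[r+1]C[r+1] (suc q) r = divides ((r ℕ.+ q ℕ.* suc r) C r) (ℕP.*-cancelˡ-≡ _ _ (suc r) (trans
  ([k+1]*[n+1]C[k+1]≡[n+1]*nCk (r ℕ.+ q ℕ.* suc r) r)
  (swap (suc q) (suc r) ((r ℕ.+ q ℕ.* suc r) C r))))
  where
  swap : ∀ p s c → p ℕ.* s ℕ.* c ≡ s ℕ.* (c ℕ.* p)
  swap = solve-∀

bernoulli : ∀ q v → suc (q ℕ.* v) ≤ suc q ℕ.^ v
bernoulli q zero    = s≤s (ℕP.≤-reflexive (ℕP.*-zeroʳ q))
bernoulli q (suc v) = begin
  suc (q ℕ.* suc v)                    ≤⟨ ℕP.m≤m+n _ (q ℕ.* (q ℕ.* v)) ⟩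
  suc (q ℕ.* suc v) ℕ.+ q ℕ.* (q ℕ.* v) ≡⟨ factor q v ⟩
  suc q ℕ.* suc (q ℕ.* v)              ≤⟨ ℕP.*-monoʳ-≤ (suc q) (bernoulli q v) ⟩
  suc q ℕ.* suc q ℕ.^ v                ∎
  where
  open ℕP.≤-Reasoning
  factor : ∀ q v → suc (q ℕ.* suc v) ℕ.+ q ℕ.* (q ℕ.* v) ≡ suc q ℕ.* suc (q ℕ.* v)
  factor = solve-∀

-- Bernoulli's inequality is strict from exponent 2 on. This excludes every p-power beyond y and yᵖ
-- from the surviving terms of the logarithm.
bernoulli-strict : ∀ q v → let q+1 = suc q in suc (q+1 ℕ.* (2 ℕ.+ v)) < suc q+1 ℕ.^ (2 ℕ.+ v)
bernoulli-strict q v = begin-strict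
  suc (suc q ℕ.* (2 ℕ.+ v))                                       <⟨ ℕP.m<m+n _ (s≤s z≤n) ⟩
  suc (suc q ℕ.* (2 ℕ.+ v)) ℕ.+ suc q ℕ.* (suc q ℕ.* suc v)        ≡⟨ factor q v ⟩
  suc (suc q) ℕ.* suc (suc q ℕ.* suc v)                           ≤⟨ ℕP.*-monoʳ-≤ (2 ℕ.+ q) (bernoulli (suc q) (suc v)) ⟩
  suc (suc q) ℕ.^ (2 ℕ.+ v)                                       ∎
  where
  open ℕP.≤-Reasoning
  factor : ∀ q v → suc (suc q ℕ.* (2 ℕ.+ v)) ℕ.+ suc q ℕ.* (suc q ℕ.* suc v) ≡ suc (suc q) ℕ.* suc (suc q ℕ.* suc v)
  factor = solve-∀

sgn-double : ∀ h → sgn (h ℕ.+ h) ≡ 1ℚ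
sgn-double zero    = refl
sgn-double (suc h) = begin
  sgn (suc (h ℕ.+ suc h))    ≡⟨ sgn-suc (h ℕ.+ suc h) ⟩
  - sgn (h ℕ.+ suc h)        ≡⟨ cong (λ n → - sgn n) (ℕP.+-suc h h) ⟩
  - sgn (suc (h ℕ.+ h))      ≡⟨ cong -_ (sgn-suc (h ℕ.+ h)) ⟩
  - - sgn (h ℕ.+ h)          ≡⟨ cong (λ x → - - x) (sgn-double h) ⟩
  1ℚ                         ∎
  where open ≡-Reasoning

even⊎odd : ∀ n → (∃ λ h → n ≡ h ℕ.+ h) ⊎ (∃ λ h → n ≡ suc (h ℕ.+ h))
even⊎odd zero    = inj₁ (0 , refl)
even⊎odd (suc n) = [ (λ (h , eq) → inj₂ (h , cong suc eq)) , (λ (h , eq) → inj₁ (suc h , trans (cong suc eq) (cong suc (sym (ℕP.+-suc h h))))) ]′ (even⊎odd n)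

-- `powCoef-log` solved for its term i = 0. On the right, the same degree occurs only with the
-- smaller power k, and larger powers occur only in smaller degrees; this fixes the order of all
-- later inductions.
powCoef-suc-log : ∀ k m → powCoef (suc k) (suc m) ≡
  powCoef k (suc m) + - diag (λ i j → logCoef (suc i) * powCoef (suc (suc i ℕ.+ k)) j) m
powCoef-suc-log k m = begin
  x                          ≡⟨ solve 2 (λ x d → x := (con 1ℚ :* x :+ d) :+ (:- d)) refl x d ⟩
  (1ℚ * x + d) + - d         ≡⟨ cong (_+ - d) (powCoef-log (suc m) k) ⟩
  powCoef k (suc m) + - d    ∎
  where
  open ≡-Reasoning
  x = powCoef (suc k) (suc m)
  d = diag (λ i j → logCoef (suc i) * powCoef (suc (suc i ℕ.+ k)) j) m

powCoef-0 : ∀ k → powCoef k 0 ≡ 1ℚ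
powCoef-0 zero    = refl
powCoef-0 (suc k) = trans (sym (ℚP.*-identityˡ _)) (trans (powCoef-log 0 k) (powCoef-0 k))

diag-closed : (Q : ℚ → Set) → (∀ {x y} → Q x → Q y → Q (x + y)) →
  ∀ h m → (∀ i j → i ℕ.+ j ≡ m → Q (h i j)) → Q (diag h m)
diag-closed Q Q-+ h zero    Qh = Qh 0 0 refl
diag-closed Q Q-+ h (suc m) Qh =
  Q-+ (Qh 0 (suc m) refl) (diag-closed Q Q-+ (λ i → h (suc i)) m (λ i j eq → Qh (suc i) j (cong suc eq)))

sgn*sgn≡1 : ∀ r → sgn r * sgn r ≡ 1ℚ
sgn*sgn≡1 zero    = refl
sgn*sgn≡1 (suc r) = trans (cong₂ _*_ (sgn-suc r) (sgn-suc r))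
  (trans (solve 1 (λ s → (:- s) :* (:- s) := s :* s) refl (sgn r)) (sgn*sgn≡1 r))

↧*x≡↥ : ∀ x → ℕ→ℚ (↧ₙ x) * x ≡ ι (↥ x)
↧*x≡↥ x@record{} = trans (ℚP.*-comm (ℕ→ℚ (↧ₙ x)) x) (trans (cong (_* ℕ→ℚ (↧ₙ x)) (sym (ℚP.↥p/↧p≡p x))) (/-*-cancel (↥ x) (↧ₙ x)))

∣∣-nonZero : ∀ {z} → z ≢ + 0 → NonZero ∣ z ∣
∣∣-nonZero {+ zero}   z≢0 = ⊥-elim (z≢0 refl)
∣∣-nonZero {+ suc n}  _   = _
∣∣-nonZero { -[1+ n ]} _  = _

diff-cong : ∀ {a b c d} → a ℕ.+ d ≡ c ℕ.+ b → + a ℤ.- + b ≡ + c ℤ.- + d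
diff-cong {a} {b} {c} {d} eq = begin
  + a ℤ.- + b                             ≡⟨ insert (+ a) (+ b) (+ d) ⟩
  (+ a ℤ.+ + d) ℤ.- (+ b ℤ.+ + d)         ≡⟨ cong (ℤ._- (+ b ℤ.+ + d)) (cong +_ eq) ⟩
  (+ c ℤ.+ + b) ℤ.- (+ b ℤ.+ + d)         ≡⟨ delete (+ c) (+ b) (+ d) ⟩
  + c ℤ.- + d                             ∎
  where
  open ≡-Reasoning
  insert : ∀ a b d → a ℤ.- b ≡ (a ℤ.+ d) ℤ.- (b ℤ.+ d)
  insert = ℤSolver.solve-∀
  delete : ∀ c b d → (c ℤ.+ b) ℤ.- (b ℤ.+ d) ≡ c ℤ.- d
  delete = ℤSolver.solve-∀

diff-injective : ∀ {a b c d} → + a ℤ.- + b ≡ + c ℤ.- + d → a ℕ.+ d ≡ c ℕ.+ b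
diff-injective {a} {b} {c} {d} eq = ℤP.+-injective (begin
  + a ℤ.+ + d                       ≡⟨ insert (+ a) (+ b) (+ d) ⟩
  (+ a ℤ.- + b) ℤ.+ (+ b ℤ.+ + d)   ≡⟨ cong (ℤ._+ (+ b ℤ.+ + d)) eq ⟩
  (+ c ℤ.- + d) ℤ.+ (+ b ℤ.+ + d)   ≡⟨ delete (+ c) (+ b) (+ d) ⟩
  + c ℤ.+ + b                       ∎)
  where
  open ≡-Reasoning
  insert : ∀ a b d → a ℤ.+ d ≡ (a ℤ.- b) ℤ.+ (b ℤ.+ d)
  insert = ℤSolver.solve-∀
  delete : ∀ c b d → (c ℤ.- d) ℤ.+ (b ℤ.+ d) ≡ c ℤ.+ b
  delete = ℤSolver.solve-∀

-- With p a double successor, the definitions by cases on p reduce, and q = p - 1 is visibly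
-- positive.
module Local (q′ : ℕ) (p-prime : Prime (suc (suc q′))) where

  q p : ℕ
  q = suc q′
  p = suc q

  P^ : ℕ → ℚ
  P^ e = ℕ→ℚ (p ℕ.^ e)

  P^-+ : ∀ e f → P^ (e ℕ.+ f) ≡ P^ e * P^ f
  P^-+ e f = trans (cong ℕ→ℚ (ℕP.^-distribˡ-+-* p e f)) (ℕ→ℚ-* (p ℕ.^ e) (p ℕ.^ f))

  P^-suc : ∀ e → P^ (suc e) ≡ ℕ→ℚ p * P^ e
  P^-suc e = ℕ→ℚ-* p (p ℕ.^ e)

  p∤1 : ¬ p ∣ 1
  p∤1 = >⇒∤ (s≤s (s≤s z≤n))

  p∤-* : ∀ {m n} → ¬ p ∣ m → ¬ p ∣ n → ¬ p ∣ m ℕ.* n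
  p∤-* {m} {n} p∤m p∤n p∣mn = [ p∤m , p∤n ]′ (euclidsLemma m n p-prime p∣mn)

  p∤⇒nonZero : ∀ {m} → ¬ p ∣ m → NonZero m
  p∤⇒nonZero {zero}  p∤0 = ⊥-elim (p∤0 (divides 0 refl))
  p∤⇒nonZero {suc m} _   = _

  factorise : ∀ n .{{_ : NonZero n}} → ∃ λ v → ∃ λ u → n ≡ p ℕ.^ v ℕ.* u × ¬ p ∣ u
  factorise n = go n (<-wellFounded n)
    where
    go : ∀ n .{{_ : NonZero n}} → Acc _<_ n → ∃ λ v → ∃ λ u → n ≡ p ℕ.^ v ℕ.* u × ¬ p ∣ u
    go n (acc rs) with p ∣? n
    ... | no p∤n = 0 , n , sym (ℕP.+-identityʳ n) , p∤n
    ... | yes (divides (suc c) refl) with go (suc c) (rs (ℕP.m<m*n (suc c) p (s≤s (s≤s z≤n))))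
    ...   | v , u , eq , p∤u = suc v , u , (begin
      suc c ℕ.* p            ≡⟨ cong (ℕ._* p) eq ⟩
      p ℕ.^ v ℕ.* u ℕ.* p    ≡⟨ rotate (p ℕ.^ v) u p ⟩
      p ℕ.^ suc v ℕ.* u      ∎) , p∤u
      where
      open ≡-Reasoning
      rotate : ∀ a b c → a ℕ.* b ℕ.* c ≡ c ℕ.* a ℕ.* b
      rotate = solve-∀

  -- The local ring ℤ₍ₚ₎ and its maximal ideal

  -- The fraction need not be in lowest terms, so sums and products are formed without any gcd.
  record Integral (x : ℚ) : Set where
    constructor integral
    field
      den     : ℕ
      num     : ℤ
      p∤den   : ¬ p ∣ den
      den*x≡num : ℕ→ℚ den * x ≡ ι num

  Integral-ι : ∀ z → Integral (ι z)
  Integral-ι z = integral 1 z p∤1 (ℚP.*-identityˡ (ι z))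

  Integral-+ : ∀ {x y} → Integral x → Integral y → Integral (x + y)
  Integral-+ {x} {y} (integral d a p∤d dx≡a) (integral e b p∤e ey≡b) =
    integral (d ℕ.* e) (+ e ℤ.* a ℤ.+ + d ℤ.* b) (p∤-* p∤d p∤e) (begin
      ℕ→ℚ (d ℕ.* e) * (x + y)              ≡⟨ cong (_* (x + y)) (ℕ→ℚ-* d e) ⟩
      ℕ→ℚ d * ℕ→ℚ e * (x + y)              ≡⟨ solve 4 (λ d e x y → d :* e :* (x :+ y) := e :* (d :* x) :+ d :* (e :* y)) refl (ℕ→ℚ d) (ℕ→ℚ e) x y ⟩
      ℕ→ℚ e * (ℕ→ℚ d * x) + ℕ→ℚ d * (ℕ→ℚ e * y) ≡⟨ cong₂ (λ u v → ℕ→ℚ e * u + ℕ→ℚ d * v) dx≡a ey≡b ⟩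
      ℕ→ℚ e * ι a + ℕ→ℚ d * ι b            ≡⟨ cong₂ _+_ (ι-* (+ e) a) (ι-* (+ d) b) ⟨
      ι (+ e ℤ.* a) + ι (+ d ℤ.* b)        ≡⟨ ι-+ (+ e ℤ.* a) (+ d ℤ.* b) ⟨
      ι (+ e ℤ.* a ℤ.+ + d ℤ.* b)          ∎)
    where open ≡-Reasoning

  Integral-* : ∀ {x y} → Integral x → Integral y → Integral (x * y)
  Integral-* {x} {y} (integral d a p∤d dx≡a) (integral e b p∤e ey≡b) =
    integral (d ℕ.* e) (a ℤ.* b) (p∤-* p∤d p∤e) (begin
      ℕ→ℚ (d ℕ.* e) * (x * y)              ≡⟨ cong (_* (x * y)) (ℕ→ℚ-* d e) ⟩
      ℕ→ℚ d * ℕ→ℚ e * (x * y)              ≡⟨ solve 4 (λ d e x y → d :* e :* (x :* y) := (d :* x) :* (e :* y)) refl (ℕ→ℚ d) (ℕ→ℚ e) x y ⟩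
      (ℕ→ℚ d * x) * (ℕ→ℚ e * y)            ≡⟨ cong₂ _*_ dx≡a ey≡b ⟩
      ι a * ι b                            ≡⟨ ι-* a b ⟨
      ι (a ℤ.* b)                          ∎)
    where open ≡-Reasoning

  Integral-neg : ∀ {x} → Integral x → Integral (- x)
  Integral-neg {x} Ix = subst Integral (solve 1 (λ x → (:- con 1ℚ) :* x := :- x) refl x) (Integral-* (Integral-ι (ℤ.- + 1)) Ix)

  Integral-cancel : ∀ {u x} → ¬ p ∣ u → Integral (ℕ→ℚ u * x) → Integral x
  Integral-cancel {u} {x} p∤u (integral d a p∤d dux≡a) =
    integral (d ℕ.* u) a (p∤-* p∤d p∤u) (trans (cong (_* x) (ℕ→ℚ-* d u)) (trans (ℚP.*-assoc (ℕ→ℚ d) (ℕ→ℚ u) x) dux≡a))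

  record Small (x : ℚ) : Set where
    constructor small
    field
      quotient : ℚ
      isIntegral : Integral quotient
      x≡p*quotient : x ≡ ℕ→ℚ p * quotient

  Small-+ : ∀ {x y} → Small x → Small y → Small (x + y)
  Small-+ (small a Ia refl) (small b Ib refl) = small (a + b) (Integral-+ Ia Ib) (sym (ℚP.*-distribˡ-+ (ℕ→ℚ p) a b))

  Small-*ˡ : ∀ {x y} → Integral x → Small y → Small (x * y)
  Small-*ˡ {x} Ix (small b Ib refl) = small (x * b) (Integral-* Ix Ib)
    (solve 3 (λ x p b → x :* (p :* b) := p :* (x :* b)) refl x (ℕ→ℚ p) b)

  Small-neg : ∀ {x} → Small x → Small (- x)
  Small-neg (small a Ia refl) = small (- a) (Integral-neg Ia) (ℚP.neg-distribʳ-* (ℕ→ℚ p) a)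

  p∣⇒Small : ∀ {n} → p ∣ n → Small (ℕ→ℚ n)
  p∣⇒Small (divides c refl) = small (ℕ→ℚ c) (Integral-ι (+ c)) (trans (ℕ→ℚ-* c p) (ℚP.*-comm (ℕ→ℚ c) (ℕ→ℚ p)))

  -- Isolates the single term of a convolution that survives modulo p. Writing the degree as `c + m`
  -- puts `h c m` on the diagonal.
  Small-diag-split : ∀ c m h → (∀ i j → i ℕ.+ j ≡ c ℕ.+ m → i ≢ c → Small (h i j)) →
    Small (diag h (c ℕ.+ m) + - h c m)
  Small-diag-split zero    zero    h Sh = subst Small (sym (ℚP.+-inverseʳ (h 0 0))) (p∣⇒Small (divides 0 refl))
  Small-diag-split zero    (suc m) h Sh =
    subst Small (solve 2 (λ x d → d := (x :+ d) :+ (:- x)) refl (h 0 (suc m)) (diag (λ i → h (suc i)) m))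
      (diag-closed Small Small-+ (λ i → h (suc i)) m (λ i j eq → Sh (suc i) j (cong suc eq) (λ ())))
  Small-diag-split (suc c) m       h Sh =
    subst Small (sym (ℚP.+-assoc (h 0 (suc (c ℕ.+ m))) (diag (λ i → h (suc i)) (c ℕ.+ m)) (- h (suc c) m)))
      (Small-+ (Sh 0 (suc (c ℕ.+ m)) refl (λ ()))
        (Small-diag-split c m (λ i → h (suc i)) (λ i j eq i≢c → Sh (suc i) j (cong suc eq) (λ eq′ → i≢c (ℕP.suc-injective eq′)))))

  -- The coefficients of the powers of (eᵗ − 1)/t modulo p

  -- Here v = ν_p(i + 1), and the bound is 1 + (p-1) v ≤ pᵛ ≤ i + 1.
  q*v≤i : ∀ {i v u} → suc i ≡ p ℕ.^ v ℕ.* u → ¬ p ∣ u → q ℕ.* v ≤ i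
  q*v≤i {i} {v} {u} eq p∤u = ℕP.≤-pred (begin
    suc (q ℕ.* v)    ≤⟨ bernoulli q v ⟩
    p ℕ.^ v          ≤⟨ ℕP.m≤m*n (p ℕ.^ v) u {{p∤⇒nonZero p∤u}} ⟩
    p ℕ.^ v ℕ.* u    ≡⟨ eq ⟨
    suc i            ∎)
    where open ℕP.≤-Reasoning

  -- Equality forces i = 0 for v = 0 and i = p - 1 for v = 1, and contradicts strict Bernoulli for v
  -- at least 2. The two exceptions are the terms y and yᵖ.
  q*v<i : ∀ {i v u} → suc i ≡ p ℕ.^ v ℕ.* u → ¬ p ∣ u → i ≢ 0 → i ≢ q → q ℕ.* v < i
  q*v<i {i} {v} {u} eq p∤u i≢0 i≢q = ℕP.≤∧≢⇒< (q*v≤i eq p∤u) (λ e → excluded v u (sym e) p∤u eq)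
    where
    excluded : ∀ v u → i ≡ q ℕ.* v → ¬ p ∣ u → suc i ≡ p ℕ.^ v ℕ.* u → ⊥
    excluded zero          u e p∤u eq = i≢0 (trans e (ℕP.*-zeroʳ q))
    excluded (suc zero)    u e p∤u eq = i≢q (trans e (ℕP.*-identityʳ q))
    excluded (suc (suc v)) u e p∤u eq = ℕP.<-irrefl refl (begin-strict
      suc (q ℕ.* (2 ℕ.+ v))     <⟨ bernoulli-strict q′ v ⟩
      p ℕ.^ (2 ℕ.+ v)           ≤⟨ ℕP.m≤m*n (p ℕ.^ (2 ℕ.+ v)) u {{p∤⇒nonZero p∤u}} ⟩
      p ℕ.^ (2 ℕ.+ v) ℕ.* u     ≡⟨ eq ⟨
      suc i                     ≡⟨ cong suc e ⟩
      suc (q ℕ.* (2 ℕ.+ v))     ∎)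
      where open ℕP.≤-Reasoning

  -- Of the denominator i + 1 = pᵛ u, the factor pᵛ is absorbed by the scaling and u is a unit of
  -- the local ring.
  logCoef-term : ∀ i {v u} f x → suc i ≡ p ℕ.^ v ℕ.* u → ¬ p ∣ u → Integral (P^ f * x) →
    Integral (P^ (v ℕ.+ f) * (logCoef i * x))
  logCoef-term i {v} {u} f x eq p∤u Ix = Integral-cancel p∤u (subst Integral (sym (begin
    ℕ→ℚ u * (P^ (v ℕ.+ f) * (L * x))     ≡⟨ cong (λ e → ℕ→ℚ u * (e * (L * x))) (P^-+ v f) ⟩
    ℕ→ℚ u * (P^ v * P^ f * (L * x))      ≡⟨ solve 5 (λ u v f L x → u :* (v :* f :* (L :* x)) := (L :* (v :* u)) :* (f :* x)) refl (ℕ→ℚ u) (P^ v) (P^ f) L x ⟩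
    (L * (P^ v * ℕ→ℚ u)) * (P^ f * x)    ≡⟨ cong (λ e → (L * e) * (P^ f * x)) (trans (sym (ℕ→ℚ-* (p ℕ.^ v) u)) (cong ℕ→ℚ (sym eq))) ⟩
    (L * ℕ→ℚ (suc i)) * (P^ f * x)       ≡⟨ cong (_* (P^ f * x)) (logCoef-* i) ⟩
    sgn i * (P^ f * x)                   ∎)) (Integral-* (Integral-ι ((ℤ.- + 1) ℤ.^ i)) Ix))
    where
    open ≡-Reasoning
    L = logCoef i

  scale-split : ∀ {v e} → v ≤ e → q ℕ.* suc e ≡ q ℕ.* v ℕ.+ q ℕ.* suc (e ∸ v)
  scale-split {v} {e} v≤e = begin
    q ℕ.* suc e                     ≡⟨ cong (λ n → q ℕ.* suc n) (ℕP.m+[n∸m]≡n v≤e) ⟨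
    q ℕ.* suc (v ℕ.+ (e ∸ v))       ≡⟨ cong (q ℕ.*_) (ℕP.+-suc v (e ∸ v)) ⟨
    q ℕ.* (v ℕ.+ suc (e ∸ v))       ≡⟨ ℕP.*-distribˡ-+ q v (suc (e ∸ v)) ⟩
    q ℕ.* v ℕ.+ q ℕ.* suc (e ∸ v)   ∎
    where open ≡-Reasoning

  -- The condition `j < q * suc f` says ⌊j/(p-1)⌋ ≤ f without a division. Of the e available factors
  -- p, v pay for the logarithm coefficient, and the other e - v still suffice for degree j.
  term-integral′ : ∀ i e j x v u → suc i ≡ p ℕ.^ v ℕ.* u → ¬ p ∣ u → q ℕ.* v ℕ.+ j < q ℕ.* suc e →
    (∀ f → j < q ℕ.* suc f → Integral (P^ f * x)) → Integral (P^ e * (logCoef i * x))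
  term-integral′ i e j x v u eq p∤u qv+j< Ix = subst (λ n → Integral (P^ n * (logCoef i * x))) (ℕP.m+[n∸m]≡n v≤e)
    (logCoef-term i {v} {u} (e ∸ v) x eq p∤u
      (Ix (e ∸ v) (ℕP.+-cancelˡ-< (q ℕ.* v) j (q ℕ.* suc (e ∸ v)) (subst (q ℕ.* v ℕ.+ j <_) (scale-split v≤e) qv+j<))))
    where
    v≤e : v ≤ e
    v≤e = ℕP.≤-pred (ℕP.*-cancelˡ-< q v (suc e) (ℕP.≤-<-trans (ℕP.m≤m+n (q ℕ.* v) j) qv+j<))

  term-integral : ∀ i e j x → i ℕ.+ j < q ℕ.* suc e →
    (∀ f → j < q ℕ.* suc f → Integral (P^ f * x)) → Integral (P^ e * (logCoef i * x))
  term-integral i e j x i+j< Ix =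
    let v , u , eq , p∤u = factorise (suc i)
    in term-integral′ i e j x v u eq p∤u (ℕP.≤-<-trans (ℕP.+-monoˡ-≤ j (q*v≤i {i} {v} {u} eq p∤u)) i+j<) Ix

  -- Since (p-1) v < i, already e factors p make the term integral; the scaling by e + 1 of them
  -- leaves one to spare.
  term-small : ∀ i e j x → i ≢ 0 → i ≢ q → i ℕ.+ j ≡ q ℕ.* suc e →
    (∀ f → j < q ℕ.* suc f → Integral (P^ f * x)) → Small (P^ (suc e) * (logCoef i * x))
  term-small i e j x i≢0 i≢q i+j≡ Ix =
    let v , u , eq , p∤u = factorise (suc i)
    in small (P^ e * (logCoef i * x))
         (term-integral′ i e j x v u eq p∤u
           (ℕP.<-≤-trans (ℕP.+-monoˡ-< j (q*v<i {i} {v} {u} eq p∤u i≢0 i≢q)) (ℕP.≤-reflexive i+j≡)) Ix)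
         (trans (cong (_* (logCoef i * x)) (P^-suc e)) (ℚP.*-assoc (ℕ→ℚ p) (P^ e) (logCoef i * x)))

  -- The bound b makes the induction on the degree structural, for all powers at once because the
  -- recursion raises them; within one degree k decreases.
  powCoef-integral : ∀ b m → m ≤ b → ∀ k e → m < q ℕ.* suc e → Integral (P^ e * powCoef k m)
  powCoef-integral b zero m≤b k e m<q =
    Integral-* (Integral-ι (+ (p ℕ.^ e))) (subst Integral (sym (powCoef-0 k)) (Integral-ι (+ 1)))
  powCoef-integral b       (suc m) m≤b zero    e m<q = Integral-* (Integral-ι (+ (p ℕ.^ e))) (Integral-ι (+ 0))
  powCoef-integral (suc b) (suc m) m≤b (suc k) e m<q = subst Integral (sym (begin
    P^ e * powCoef (suc k) (suc m)             ≡⟨ cong (P^ e *_) (powCoef-suc-log k m) ⟩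
    P^ e * (powCoef k (suc m) + - diag t m)     ≡⟨ solve 3 (λ P x d → P :* (x :+ (:- d)) := P :* x :+ (:- (P :* d))) refl (P^ e) (powCoef k (suc m)) (diag t m) ⟩
    P^ e * powCoef k (suc m) + - (P^ e * diag t m) ≡⟨ +-congˡ (P^ e * powCoef k (suc m)) (cong -_ (sym (diag-* (P^ e) t m))) ⟩
    P^ e * powCoef k (suc m) + - diag (λ i j → P^ e * t i j) m ∎))
    (Integral-+ (powCoef-integral (suc b) (suc m) m≤b k e m<q)
      (Integral-neg (diag-closed Integral Integral-+ (λ i j → P^ e * t i j) m term)))
    where
    open ≡-Reasoning
    t : ℕ → ℕ → ℚ
    t i j = logCoef (suc i) * powCoef (suc (suc i ℕ.+ k)) j
    term : ∀ i j → i ℕ.+ j ≡ m → Integral (P^ e * t i j)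
    term i j refl = term-integral (suc i) e j (powCoef (suc (suc i ℕ.+ k)) j) m<q
      (powCoef-integral b j (ℕP.≤-trans (ℕP.m≤n+m j i) (ℕP.≤-pred m≤b)) (suc (suc i ℕ.+ k)))

  -- If p - 1 is odd, then 2 divides the prime p, so p = 2 and -1 ≡ 1 modulo p.
  sgn-q : Small (sgn q + - 1ℚ)
  sgn-q with even⊎odd q
  ... | inj₁ (h , eq) = subst (λ x → Small (x + - 1ℚ)) (sym (trans (cong sgn eq) (sgn-double h))) (p∣⇒Small (divides 0 refl))
  ... | inj₂ (h , eq) with prime⇒irreducible p-prime (divides (suc h) (trans (cong suc eq) (double h)))
    where
    double : ∀ h → suc (suc (h ℕ.+ h)) ≡ suc h ℕ.* 2
    double = solve-∀
  ...   | inj₂ refl = Small-neg (p∣⇒Small (divides 1 refl))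

  -- For n = k + (p-1) r the upper index k + p r equals n + r.
  Congruence : ℕ → ℕ → Set
  Congruence r k = Small (P^ r * powCoef k (q ℕ.* r) + - (sgn r * ℕ→ℚ ((k ℕ.+ p ℕ.* r) C r)))

  -- Only the terms y and (−1)ᵖ⁻¹ yᵖ/p of log (1 + y) survive modulo p after the scaling
  -- by P^ r, and Pascal's rule has the resulting two-term recursion.
  congruence-step : ∀ r k → Congruence (suc r) k → Congruence r (p ℕ.+ k) → Congruence (suc r) (suc k)
  congruence-step r k previousₖ previousᵣ = subst Small (sym (begin
    P′ * powCoef (suc k) (q ℕ.* suc r) + - (sgn (suc r) * ℕ→ℚ (suc (k ℕ.+ p ℕ.* suc r) C suc r))
      ≡⟨ cong₂ (λ x y → P′ * x + - y) coefficient (cong₂ _*_ (sgn-suc r) (trans (cong ℕ→ℚ (sym (nCk+nC[k+1]≡[n+1]C[k+1] N r))) (ℕ→ℚ-+ (N C r) (N C suc r)))) ⟩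
    P′ * (A + - D) + - (- sgn r * (C₁ + C₂))
      -- The error splits into four small parts: the congruence for power k, the discarded terms of
      -- the logarithm, the replacement of (-1)^(p-1) by 1, and the congruence for power p + k.
      ≡⟨ solve 8 (λ P A D s C₁ C₂ σ X → P :* (A :+ (:- D)) :+ (:- ((:- s) :* (C₁ :+ C₂)))
             := ((P :* A :+ (:- ((:- s) :* C₂))) :+ (:- (P :* D :+ (:- (σ :* X))))) :+ ((:- (X :* (σ :+ (:- con 1ℚ)))) :+ (:- (X :+ (:- (s :* C₁))))))
           refl P′ A D (sgn r) C₁ C₂ (sgn q) X ⟩
    ((P′ * A + - (- sgn r * C₂)) + - (P′ * D + - (sgn q * X))) + (- (X * (sgn q + - 1ℚ)) + - (X + - (sgn r * C₁))) ∎))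
    (Small-+ (Small-+ previous (Small-neg middle)) (Small-+ (Small-neg (Small-*ˡ IX sgn-q)) (Small-neg lower)))
    where
    open ≡-Reasoning
    -- Both induction hypotheses have this upper index, as (p + k) + p r = k + p (r + 1); hence
    -- Pascal's rule applies.
    N = k ℕ.+ p ℕ.* suc r
    M = q′ ℕ.+ q ℕ.* r
    P′ = P^ (suc r)
    A = powCoef k (suc M)
    X = P^ r * powCoef (p ℕ.+ k) (q ℕ.* r)
    C₁ = ℕ→ℚ (N C r)
    C₂ = ℕ→ℚ (N C suc r)
    t : ℕ → ℕ → ℚ
    t i j = logCoef (suc i) * powCoef (suc (suc i ℕ.+ k)) j
    D = diag t M
    coefficient : powCoef (suc k) (q ℕ.* suc r) ≡ A + - D
    coefficient = trans (cong (powCoef (suc k)) (ℕP.*-suc q r)) (powCoef-suc-log k M)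
    previous : Small (P′ * A + - (- sgn r * C₂))
    previous = subst₂ (λ m s → Small (P′ * powCoef k m + - (s * C₂))) (ℕP.*-suc q r) (sgn-suc r) previousₖ
    lower : Small (X + - (sgn r * C₁))
    lower = subst (λ n → Small (X + - (sgn r * ℕ→ℚ (n C r)))) (reindex p k r) previousᵣ
      where
      reindex : ∀ p k r → p ℕ.+ k ℕ.+ p ℕ.* r ≡ k ℕ.+ p ℕ.* suc r
      reindex = solve-∀
    IX : Integral X
    IX = powCoef-integral (q ℕ.* r) (q ℕ.* r) ℕP.≤-refl (p ℕ.+ k) r (ℕP.*-monoʳ-< q (ℕP.n<1+n r))
    -- Index `q′` of `t` belongs to yᵖ, whose denominator p uses up one factor of `P′`.
    exceptional : P′ * t q′ (q ℕ.* r) ≡ sgn q * X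
    exceptional = begin
      P′ * (logCoef q * a)                   ≡⟨ cong (_* (logCoef q * a)) (P^-suc r) ⟩
      ℕ→ℚ p * P^ r * (logCoef q * a)         ≡⟨ solve 4 (λ p P l a → p :* P :* (l :* a) := (l :* p) :* (P :* a)) refl (ℕ→ℚ p) (P^ r) (logCoef q) a ⟩
      logCoef q * ℕ→ℚ p * X                  ≡⟨ cong (_* X) (logCoef-* q) ⟩
      sgn q * X                              ∎
      where a = powCoef (p ℕ.+ k) (q ℕ.* r)
    negligible : ∀ i j → i ℕ.+ j ≡ M → i ≢ q′ → Small (P′ * t i j)
    negligible i j i+j≡M i≢q′ = term-small (suc i) r j (powCoef (suc (suc i ℕ.+ k)) j) (λ ())
      (λ e → i≢q′ (ℕP.suc-injective e)) (trans (cong suc i+j≡M) (sym (ℕP.*-suc q r)))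
      (powCoef-integral j j ℕP.≤-refl (suc (suc i ℕ.+ k)))
    middle : Small (P′ * D + - (sgn q * X))
    middle = subst₂ (λ x y → Small (x + - y)) (diag-* P′ t M) exceptional
      (Small-diag-split q′ (q ℕ.* r) (λ i j → P′ * t i j) negligible)

  -- Lexicographic induction on (r, k): the power rises to p + k only where r falls. For k = 0 and
  -- positive r the coefficient is 0 and the binomial coefficient is divisible by p.
  powCoef-congruence : ∀ r k → Congruence r k
  powCoef-congruence zero k = subst Small (sym (begin
    1ℚ * powCoef k (q ℕ.* 0) + - (1ℚ * ℕ→ℚ ((k ℕ.+ p ℕ.* 0) C 0))
      ≡⟨ cong₂ (λ x y → 1ℚ * x + - (1ℚ * y)) (trans (cong (powCoef k) (ℕP.*-zeroʳ q)) (powCoef-0 k)) (cong ℕ→ℚ (nC0≡1 (k ℕ.+ p ℕ.* 0))) ⟩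
    0ℚ ∎)) (p∣⇒Small (divides 0 refl))
    where open ≡-Reasoning
  powCoef-congruence (suc r) zero = subst Small
    (sym (trans (cong (_+ - (sgn (suc r) * c)) (ℚP.*-zeroʳ (P^ (suc r)))) (ℚP.+-identityˡ _)))
    (Small-neg (Small-*ˡ (Integral-ι ((ℤ.- + 1) ℤ.^ suc r)) (p∣⇒Small (p∣p[r+1]C[r+1] p r))))
    where c = ℕ→ℚ ((p ℕ.* suc r) C suc r)
  powCoef-congruence (suc r) (suc k) =
    congruence-step r k (powCoef-congruence (suc r) k) (powCoef-congruence r (p ℕ.+ k))

  -- Valuations

  -- Division by p strictly lowers a positive m, so fuel that is at least m does not run out.
  vℕ-fuel-exact : ∀ f a u m → m ≡ p ℕ.^ a ℕ.* u → ¬ p ∣ u → m ≤ f → vℕ-fuel p f m ≡ a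
  vℕ-fuel-exact f a u zero eq p∤u _ =
    ⊥-elim (p∤u (subst (p ∣_) (sym u≡0) (divides 0 refl)))
    where
    u≡0 : u ≡ 0
    u≡0 = [ (λ e → ⊥-elim (ℕ.≢-nonZero⁻¹ (p ℕ.^ a) {{ℕP.m^n≢0 p a}} e)) , (λ e → e) ]′ (ℕP.m*n≡0⇒m≡0∨n≡0 (p ℕ.^ a) (sym eq))
  vℕ-fuel-exact (suc f) a u (suc m) eq p∤u (s≤s m≤f) with p ∣? suc m
  vℕ-fuel-exact (suc f) zero    u (suc m) eq p∤u (s≤s m≤f) | no  p∤m = refl
  vℕ-fuel-exact (suc f) (suc a) u (suc m) eq p∤u (s≤s m≤f) | no  p∤m =
    ⊥-elim (p∤m (subst (p ∣_) (sym eq) (∣m⇒∣m*n u (m∣m*n (p ℕ.^ a)))))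
  vℕ-fuel-exact (suc f) zero    u (suc m) eq p∤u (s≤s m≤f) | yes p∣m =
    ⊥-elim (p∤u (subst (p ∣_) (trans eq (ℕP.+-identityʳ u)) p∣m))
  vℕ-fuel-exact (suc f) (suc a) u (suc m) eq p∤u (s≤s m≤f) | yes p∣m =
    cong suc (vℕ-fuel-exact f a u (suc m ℕ./ p)
      (trans (cong (ℕ._/ p) (trans eq (rotate p (p ℕ.^ a) u))) (m*n/n≡m (p ℕ.^ a ℕ.* u) p)) p∤u
      (ℕP.≤-trans (ℕP.≤-pred (m/n<m (suc m) p (s≤s (s≤s z≤n)))) m≤f))
    where
    rotate : ∀ a b c → a ℕ.* b ℕ.* c ≡ b ℕ.* c ℕ.* a
    rotate = solve-∀

  νℕ-exact : ∀ a {u} → ¬ p ∣ u → νℕ p (p ℕ.^ a ℕ.* u) ≡ a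
  νℕ-exact a {u} p∤u = vℕ-fuel-exact (p ℕ.^ a ℕ.* u) a u (p ℕ.^ a ℕ.* u) refl p∤u ℕP.≤-refl

  νℕ-∤ : ∀ {u} → ¬ p ∣ u → νℕ p u ≡ 0
  νℕ-∤ {u} p∤u = vℕ-fuel-exact u 0 u u (sym (ℕP.+-identityʳ u)) p∤u ℕP.≤-refl

  νℕ-^ : ∀ a → νℕ p (p ℕ.^ a) ≡ a
  νℕ-^ a = trans (cong (νℕ p) (sym (ℕP.*-identityʳ (p ℕ.^ a)))) (νℕ-exact a p∤1)

  νℕ-p : νℕ p p ≡ 1
  νℕ-p = trans (cong (νℕ p) (sym (ℕP.*-identityʳ p))) (νℕ-^ 1)

  νℕ-factorise : ∀ n .{{_ : NonZero n}} → ∃ λ u → n ≡ p ℕ.^ νℕ p n ℕ.* u × ¬ p ∣ u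
  νℕ-factorise n = let v , u , eq , p∤u = factorise n in
    u , trans eq (cong (λ e → p ℕ.^ e ℕ.* u) (sym (trans (cong (νℕ p) eq) (νℕ-exact v p∤u)))) , p∤u

  νℕ-* : ∀ m n .{{_ : NonZero m}} .{{_ : NonZero n}} → νℕ p (m ℕ.* n) ≡ νℕ p m ℕ.+ νℕ p n
  νℕ-* m n = let u , eq , p∤u = νℕ-factorise m ; w , eq′ , p∤w = νℕ-factorise n in begin
    νℕ p (m ℕ.* n)
      ≡⟨ cong (νℕ p) (trans (cong₂ ℕ._*_ eq eq′) (trans (interchange (p ℕ.^ νℕ p m) u (p ℕ.^ νℕ p n) w)
           (cong (ℕ._* (u ℕ.* w)) (sym (ℕP.^-distribˡ-+-* p (νℕ p m) (νℕ p n)))))) ⟩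
    νℕ p (p ℕ.^ (νℕ p m ℕ.+ νℕ p n) ℕ.* (u ℕ.* w))
      ≡⟨ νℕ-exact (νℕ p m ℕ.+ νℕ p n) (p∤-* p∤u p∤w) ⟩
    νℕ p m ℕ.+ νℕ p n ∎
    where
    open ≡-Reasoning
    interchange : ∀ a b c d → a ℕ.* b ℕ.* (c ℕ.* d) ≡ a ℕ.* c ℕ.* (b ℕ.* d)
    interchange = solve-∀

  Val : ℚ → ℤ → Set
  Val x v = ν p x ≡ just v

  νx : ℚ → ℤ
  νx x = + νℕ p ∣ ↥ x ∣ ℤ.- + νℕ p (↧ₙ x)

  ↥≢0⇒Val : ∀ x → ↥ x ≢ + 0 → Val x (νx x)
  ↥≢0⇒Val x ↥≢0 with ↥ x
  ... | + zero   = ⊥-elim (↥≢0 refl)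
  ... | + suc _  = refl
  ... | -[1+ _ ] = refl

  Val⇒↥≢0 : ∀ x {v} → Val x v → ↥ x ≢ + 0
  Val⇒↥≢0 x Vx ↥≡0 with ↥ x
  Val⇒↥≢0 x ()  ↥≡0 | + zero
  Val⇒↥≢0 x Vx () | + suc _

  Val-νx : ∀ x {v} → Val x v → v ≡ νx x
  Val-νx x Vx = just-injective (trans (sym Vx) (↥≢0⇒Val x (Val⇒↥≢0 x Vx)))

  -- `ν` is defined on lowest terms; cross-multiplication and additivity of `νℕ` carry it over to an
  -- arbitrary fraction.
  fraction⇒Val : ∀ d {z x} .{{_ : NonZero d}} → z ≢ + 0 → ℕ→ℚ d * x ≡ ι z → Val x (+ νℕ p ∣ z ∣ ℤ.- + νℕ p d)
  fraction⇒Val d {z} {x@record{}} z≢0 dx≡z = trans (↥≢0⇒Val x ↥≢0) (cong just (diff-cong {νℕ p ∣ ↥ x ∣} {νℕ p (↧ₙ x)} {νℕ p ∣ z ∣} {νℕ p d} (begin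
    νℕ p ∣ ↥ x ∣ ℕ.+ νℕ p d          ≡⟨ νℕ-* ∣ ↥ x ∣ d {{∣∣-nonZero ↥≢0}} ⟨
    νℕ p (∣ ↥ x ∣ ℕ.* d)             ≡⟨ cong (νℕ p) (trans (ℕP.*-comm ∣ ↥ x ∣ d) (trans (sym (ℤP.abs-* (+ d) (↥ x))) (trans (cong ∣_∣ cross) (ℤP.abs-* z (↧ x))))) ⟩
    νℕ p (∣ z ∣ ℕ.* ↧ₙ x)            ≡⟨ νℕ-* ∣ z ∣ (↧ₙ x) {{∣∣-nonZero z≢0}} ⟩
    νℕ p ∣ z ∣ ℕ.+ νℕ p (↧ₙ x)       ∎)))
    where
    open ≡-Reasoning
    cross : + d ℤ.* ↥ x ≡ z ℤ.* ↧ x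
    cross = ι-injective (begin
      ι (+ d ℤ.* ↥ x)           ≡⟨ ι-* (+ d) (↥ x) ⟩
      ℕ→ℚ d * ι (↥ x)           ≡⟨ cong (ℕ→ℚ d *_) (↧*x≡↥ x) ⟨
      ℕ→ℚ d * (ℕ→ℚ (↧ₙ x) * x)  ≡⟨ solve 3 (λ d e x → d :* (e :* x) := (d :* x) :* e) refl (ℕ→ℚ d) (ℕ→ℚ (↧ₙ x)) x ⟩
      (ℕ→ℚ d * x) * ℕ→ℚ (↧ₙ x)  ≡⟨ cong (_* ℕ→ℚ (↧ₙ x)) dx≡z ⟩
      ι z * ι (↧ x)             ≡⟨ ι-* z (↧ x) ⟨
      ι (z ℤ.* ↧ x)             ∎)
    ↥≢0 : ↥ x ≢ + 0
    ↥≢0 ↥≡0 = [ z≢0 , (λ ()) ]′ (ℤP.i*j≡0⇒i≡0∨j≡0 z (trans (sym cross) (trans (cong (+ d ℤ.*_) ↥≡0) (ℤP.*-zeroʳ (+ d)))))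

  Val-scale : ∀ c {x v} .{{_ : NonZero c}} → Val x v → Val (ℕ→ℚ c * x) (+ νℕ p c ℤ.+ v)
  Val-scale c@(suc _) {x@record{}} {v} Vx = trans
    (fraction⇒Val (↧ₙ x) {+ c ℤ.* ↥ x} (λ e → [ (λ ()) , Val⇒↥≢0 x Vx ]′ (ℤP.i*j≡0⇒i≡0∨j≡0 (+ c) e)) (begin
      ℕ→ℚ (↧ₙ x) * (ℕ→ℚ c * x)  ≡⟨ solve 3 (λ d e x → d :* (e :* x) := e :* (d :* x)) refl (ℕ→ℚ (↧ₙ x)) (ℕ→ℚ c) x ⟩
      ℕ→ℚ c * (ℕ→ℚ (↧ₙ x) * x)  ≡⟨ cong (ℕ→ℚ c *_) (↧*x≡↥ x) ⟩
      ℕ→ℚ c * ι (↥ x)           ≡⟨ ι-* (+ c) (↥ x) ⟨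
      ι (+ c ℤ.* ↥ x)           ∎))
    (cong just (begin
      + νℕ p ∣ + c ℤ.* ↥ x ∣ ℤ.- + νℕ p (↧ₙ x)
        ≡⟨ cong (λ e → + e ℤ.- + νℕ p (↧ₙ x)) (trans (cong (νℕ p) (ℤP.abs-* (+ c) (↥ x))) (νℕ-* c ∣ ↥ x ∣ {{_}} {{∣∣-nonZero (Val⇒↥≢0 x Vx)}})) ⟩
      (+ νℕ p c ℤ.+ + νℕ p ∣ ↥ x ∣) ℤ.- + νℕ p (↧ₙ x)
        ≡⟨ ℤP.+-assoc (+ νℕ p c) (+ νℕ p ∣ ↥ x ∣) (ℤ.- + νℕ p (↧ₙ x)) ⟩
      + νℕ p c ℤ.+ νx x
        ≡⟨ cong (λ e → + νℕ p c ℤ.+ e) (Val-νx x Vx) ⟨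
      + νℕ p c ℤ.+ v ∎))
    where open ≡-Reasoning

  Val-unscale : ∀ c {x v} .{{_ : NonZero c}} → Val (ℕ→ℚ c * x) v → Val x (v ℤ.- + νℕ p c)
  Val-unscale c@(suc _) {x} {v} Vcx = trans (↥≢0⇒Val x ↥≢0) (cong just (begin
    νx x                                     ≡⟨ cancel (+ νℕ p c) (νx x) ⟨
    (+ νℕ p c ℤ.+ νx x) ℤ.- + νℕ p c         ≡⟨ cong (ℤ._- + νℕ p c) (just-injective (trans (sym (Val-scale c {x} (↥≢0⇒Val x ↥≢0))) Vcx)) ⟩
    v ℤ.- + νℕ p c                           ∎))
    where
    open ≡-Reasoning
    cancel : ∀ a b → (a ℤ.+ b) ℤ.- a ≡ b
    cancel = ℤSolver.solve-∀
    ↥≢0 : ↥ x ≢ + 0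
    ↥≢0 ↥≡0 = Val⇒↥≢0 (ℕ→ℚ c * x) Vcx (ℚP.p≡0⇒↥p≡0 (ℕ→ℚ c * x)
      (trans (cong (ℕ→ℚ c *_) (ℚP.↥p≡0⇒p≡0 x ↥≡0)) (ℚP.*-zeroʳ (ℕ→ℚ c))))

  Small⇒PosVal : ∀ {x} → Small x → PosVal (ν p x)
  Small⇒PosVal {x} (small y (integral d z p∤d dy≡z) refl) with z ℤP.≟ + 0
  ... | yes refl = subst (λ y → PosVal (ν p (ℕ→ℚ p * y))) (sym y≡0) (subst (λ x → PosVal (ν p x)) (sym (ℚP.*-zeroʳ (ℕ→ℚ p))) tt)
    where
    y≡0 : y ≡ 0ℚ
    y≡0 = *-cancelˡ d {{p∤⇒nonZero p∤d}} (trans dy≡z (sym (ℚP.*-zeroʳ (ℕ→ℚ d))))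
  ... | no z≢0 = subst PosVal (sym (Val-scale p (fraction⇒Val d {{p∤⇒nonZero p∤d}} z≢0 dy≡z)))
    (subst₂ (λ a b → + 0 ℤ.< + a ℤ.+ (+ νℕ p ∣ z ∣ ℤ.- + b)) (sym νℕ-p) (sym (νℕ-∤ p∤d))
      (subst (λ e → + 0 ℤ.< + 1 ℤ.+ e) (sym (ℤP.+-identityʳ (+ νℕ p ∣ z ∣))) (ℤ.+<+ (s≤s z≤n))))

  Val0⇒¬Small : ∀ {x} → Val x (+ 0) → ¬ Small x
  Val0⇒¬Small Vx Sx = ℤP.<-irrefl refl (subst PosVal Vx (Small⇒PosVal Sx))

  Small⇒p∣ : ∀ {n} → Small (ℕ→ℚ n) → p ∣ n
  Small⇒p∣ {n} Sn with p ∣? n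
  ... | yes p∣n = p∣n
  ... | no  p∤n = ⊥-elim (Val0⇒¬Small {ℕ→ℚ n} (trans (fraction⇒Val 1 {+ n} n≢0 (ℚP.*-identityˡ (ℕ→ℚ n)))
      (cong just (cong₂ (λ a b → + a ℤ.- + b) (νℕ-∤ p∤n) (νℕ-∤ p∤1)))) Sn)
    where
    n≢0 : + n ≢ + 0
    n≢0 refl = p∤n (divides 0 refl)

  Small-cancel : ∀ {u x} → ¬ p ∣ u → Small (ℕ→ℚ u * x) → Small x
  Small-cancel {u} {x} p∤u (small y Iy ux≡py) = small w (Integral-cancel p∤u (subst Integral (sym uw≡y) Iy))
    (*-cancelˡ u (begin
      ℕ→ℚ u * x            ≡⟨ ux≡py ⟩
      ℕ→ℚ p * y            ≡⟨ cong (ℕ→ℚ p *_) uw≡y ⟨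
      ℕ→ℚ p * (ℕ→ℚ u * w)  ≡⟨ solve 3 (λ p u w → p :* (u :* w) := u :* (p :* w)) refl (ℕ→ℚ p) (ℕ→ℚ u) w ⟩
      ℕ→ℚ u * (ℕ→ℚ p * w)  ∎))
    where
    open ≡-Reasoning
    instance _ = p∤⇒nonZero p∤u
    w = y * (+ 1 ℚ./ u)
    uw≡y : ℕ→ℚ u * w ≡ y
    uw≡y = trans (solve 3 (λ u y i → u :* (y :* i) := y :* (i :* u)) refl (ℕ→ℚ u) y (+ 1 ℚ./ u))
      (trans (cong (y *_) (/-*-cancel (+ 1) u)) (ℚP.*-identityʳ y))

  p∣∣⇒Small : ∀ z → p ∣ ∣ z ∣ → Small (ι z)
  p∣∣⇒Small (+ n)    p∣n = p∣⇒Small p∣n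
  p∣∣⇒Small -[1+ n ] p∣n = subst Small (sym (ι-neg (+ suc n))) (Small-neg (p∣⇒Small p∣n))

  -- The units of the local ring are the complement of its maximal ideal. With `Val0⇒¬Small` this is
  -- the passage between valuations and congruences modulo p.
  integral¬Small⇒Val0 : ∀ {x} → Integral x → ¬ Small x → Val x (+ 0)
  integral¬Small⇒Val0 {x} (integral d z p∤d dx≡z) ¬Sx with p ∣? ∣ z ∣
  ... | yes p∣z = ⊥-elim (¬Sx (Small-cancel p∤d (subst Small (sym dx≡z) (p∣∣⇒Small z p∣z))))
  ... | no  p∤z = trans (fraction⇒Val d {{p∤⇒nonZero p∤d}} z≢0 dx≡z)
      (cong just (cong₂ (λ a b → + a ℤ.- + b) (νℕ-∤ p∤z) (νℕ-∤ p∤d)))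
    where
    z≢0 : z ≢ + 0
    z≢0 refl = p∤z (divides 0 refl)

  -- Determines the unit part without negative powers of p; a and b may be any naturals whose
  -- difference is the valuation.
  ε-Val : ∀ x a b → Val x (+ a ℤ.- + b) → ε p x * P^ a ≡ x * P^ b
  ε-Val x a b Vx = *-cancelˡ (p ℕ.^ n) (begin
    P^ n * (x * (P^ d * invPow p n) * P^ a)   ≡⟨ solve 5 (λ n x d i a → n :* (x :* (d :* i) :* a) := x :* (a :* d) :* (i :* n)) refl (P^ n) x (P^ d) (invPow p n) (P^ a) ⟩
    x * (P^ a * P^ d) * (invPow p n * P^ n)   ≡⟨ cong₂ (λ y z → x * y * z) (trans (sym (P^-+ a d)) (cong P^ (sym balance))) (/-*-cancel (+ 1) (p ℕ.^ n)) ⟩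
    x * P^ (n ℕ.+ b) * 1ℚ                     ≡⟨ cong (λ y → x * y * 1ℚ) (P^-+ n b) ⟩
    x * (P^ n * P^ b) * 1ℚ                    ≡⟨ solve 3 (λ x n b → x :* (n :* b) :* con 1ℚ := n :* (x :* b)) refl x (P^ n) (P^ b) ⟩
    P^ n * (x * P^ b)                         ∎)
    where
    open ≡-Reasoning
    n = νℕ p ∣ ↥ x ∣
    d = νℕ p (↧ₙ x)
    instance _ = ℕP.m^n≢0 p n
    balance : n ℕ.+ b ≡ a ℕ.+ d
    balance = diff-injective {n} {d} {a} {b} (sym (Val-νx x Vx))

  -- Legendre formula

  σ-fuel-0 : ∀ f → σ-fuel p f 0 ≡ 0
  σ-fuel-0 zero    = refl
  σ-fuel-0 (suc f) = σ-fuel-0 f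

  σ-fuel-irrelevant : ∀ f g m → m ≤ f → m ≤ g → σ-fuel p f m ≡ σ-fuel p g m
  σ-fuel-irrelevant f       g       zero    _         _         = trans (σ-fuel-0 f) (sym (σ-fuel-0 g))
  σ-fuel-irrelevant (suc f) (suc g) (suc m) (s≤s m≤f) (s≤s m≤g) = cong (suc m ℕ.% p ℕ.+_)
    (σ-fuel-irrelevant f g (suc m ℕ./ p) (ℕP.≤-trans m/p≤m m≤f) (ℕP.≤-trans m/p≤m m≤g))
    where
    m/p≤m : suc m ℕ./ p ≤ m
    m/p≤m = ℕP.≤-pred (m/n<m (suc m) p (s≤s (s≤s z≤n)))

  σ-unfold : ∀ m → σ p m ≡ m ℕ.% p ℕ.+ σ p (m ℕ./ p)
  σ-unfold zero    = refl
  σ-unfold (suc m) = cong (suc m ℕ.% p ℕ.+_)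
    (σ-fuel-irrelevant m (suc m ℕ./ p) (suc m ℕ./ p) (ℕP.≤-pred (m/n<m (suc m) p (s≤s (s≤s z≤n)))) ℕP.≤-refl)

  σ-digit : ∀ r s → r < p → σ p (r ℕ.+ s ℕ.* p) ≡ r ℕ.+ σ p s
  σ-digit r s r<p = trans (σ-unfold (r ℕ.+ s ℕ.* p)) (cong₂ (λ a b → a ℕ.+ σ p b)
    (trans ([m+kn]%n≡m%n r s p) (m<n⇒m%n≡m r<p))
    (trans (+-distrib-/-∣ʳ r (n∣m*n s)) (cong₂ ℕ._+_ (m<n⇒m/n≡0 r<p) (m*n/n≡m s p))))

  -- Adding one turns the ν_p(n+1) trailing digits p - 1 into 0 and raises the next digit by one.
  σ-carry : ∀ n → σ p (suc n) ℕ.+ q ℕ.* νℕ p (suc n) ≡ suc (σ p n)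
  σ-carry n = go n (<-wellFounded n)
    where
    go : ∀ n → Acc _<_ n → σ p (suc n) ℕ.+ q ℕ.* νℕ p (suc n) ≡ suc (σ p n)
    byDigit : ∀ r s → r < p → (s < r ℕ.+ s ℕ.* p → σ p (suc s) ℕ.+ q ℕ.* νℕ p (suc s) ≡ suc (σ p s)) →
      σ p (suc r ℕ.+ s ℕ.* p) ℕ.+ q ℕ.* νℕ p (suc r ℕ.+ s ℕ.* p) ≡ suc (σ p (r ℕ.+ s ℕ.* p))
    go n (acc rs) = subst (λ n → σ p (suc n) ℕ.+ q ℕ.* νℕ p (suc n) ≡ suc (σ p n)) (sym (m≡m%n+[m/n]*n n p))
      (byDigit (n ℕ.% p) (n ℕ./ p) (m%n<n n p)
        (λ s< → go (n ℕ./ p) (rs (subst (n ℕ./ p <_) (sym (m≡m%n+[m/n]*n n p)) s<))))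
    byDigit r s (s≤s r≤q) ih with ℕP.m≤n⇒m<n∨m≡n r≤q
    ... | inj₁ r<q = begin
      σ p (suc r ℕ.+ s ℕ.* p) ℕ.+ q ℕ.* νℕ p (suc r ℕ.+ s ℕ.* p)
        ≡⟨ cong₂ (λ a b → a ℕ.+ q ℕ.* b) (σ-digit (suc r) s (s≤s r<q)) (νℕ-∤ p∤) ⟩
      suc r ℕ.+ σ p s ℕ.+ q ℕ.* 0       ≡⟨ trans (cong (suc r ℕ.+ σ p s ℕ.+_) (ℕP.*-zeroʳ q)) (ℕP.+-identityʳ _) ⟩
      suc (r ℕ.+ σ p s)                 ≡⟨ cong suc (σ-digit r s (s≤s r≤q)) ⟨
      suc (σ p (r ℕ.+ s ℕ.* p))         ∎
      where
      open ≡-Reasoning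
      p∤ : ¬ p ∣ suc r ℕ.+ s ℕ.* p
      p∤ p∣ = >⇒∤ (s≤s r<q) (∣m+n∣m⇒∣n (subst (p ∣_) (ℕP.+-comm (suc r) (s ℕ.* p)) p∣) (n∣m*n s))
    -- The last digit is p - 1, so the carry passes to s, for which the claim holds by induction.
    ... | inj₂ refl = begin
      σ p (suc s ℕ.* p) ℕ.+ q ℕ.* νℕ p (suc s ℕ.* p)
        ≡⟨ cong₂ (λ a b → a ℕ.+ q ℕ.* b) (σ-digit 0 (suc s) (s≤s z≤n)) (trans (νℕ-* (suc s) p) (cong (νℕ p (suc s) ℕ.+_) νℕ-p)) ⟩
      σ p (suc s) ℕ.+ q ℕ.* (νℕ p (suc s) ℕ.+ 1)   ≡⟨ regroup q (σ p (suc s)) (νℕ p (suc s)) ⟩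
      σ p (suc s) ℕ.+ q ℕ.* νℕ p (suc s) ℕ.+ q     ≡⟨ cong (ℕ._+ q) (ih s<) ⟩
      suc (σ p s) ℕ.+ q                            ≡⟨ cong suc (trans (ℕP.+-comm (σ p s) q) (sym (σ-digit q s (s≤s ℕP.≤-refl)))) ⟩
      suc (σ p (q ℕ.+ s ℕ.* p))                    ∎
      where
      open ≡-Reasoning
      regroup : ∀ q a b → a ℕ.+ q ℕ.* (b ℕ.+ 1) ≡ a ℕ.+ q ℕ.* b ℕ.+ q
      regroup = solve-∀
      s< : s < q ℕ.+ s ℕ.* p
      s< = s≤s (ℕP.≤-trans (ℕP.m≤m*n s p) (ℕP.m≤n+m (s ℕ.* p) q′))

  -- The sum of `σ-carry` over the factors of n!.
  legendre : ∀ n → q ℕ.* νℕ p (n !) ℕ.+ σ p n ≡ n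
  legendre zero    = trans (cong (λ e → q ℕ.* e ℕ.+ 0) (νℕ-∤ p∤1)) (trans (ℕP.+-identityʳ (q ℕ.* 0)) (ℕP.*-zeroʳ q))
  legendre (suc n) = begin
    q ℕ.* νℕ p (suc n !) ℕ.+ σ p (suc n)
      ≡⟨ cong (λ e → q ℕ.* e ℕ.+ σ p (suc n)) (νℕ-* (suc n) (n !) {{_}} {{ℕP._!≢0 n}}) ⟩
    q ℕ.* (νℕ p (suc n) ℕ.+ νℕ p (n !)) ℕ.+ σ p (suc n)
      ≡⟨ regroup q (νℕ p (suc n)) (νℕ p (n !)) (σ p (suc n)) ⟩
    q ℕ.* νℕ p (n !) ℕ.+ (σ p (suc n) ℕ.+ q ℕ.* νℕ p (suc n))
      ≡⟨ cong (q ℕ.* νℕ p (n !) ℕ.+_) (σ-carry n) ⟩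
    q ℕ.* νℕ p (n !) ℕ.+ suc (σ p n)
      ≡⟨ ℕP.+-suc (q ℕ.* νℕ p (n !)) (σ p n) ⟩
    suc (q ℕ.* νℕ p (n !) ℕ.+ σ p n)
      ≡⟨ cong suc (legendre n) ⟩
    suc n ∎
    where
    open ≡-Reasoning
    regroup : ∀ q a b s → q ℕ.* (a ℕ.+ b) ℕ.+ s ≡ q ℕ.* b ℕ.+ (s ℕ.+ q ℕ.* a)
    regroup = solve-∀

  -- Minimum zeros and maximum poles

  MinZero : ℕ → ℕ → Set
  MinZero n k = Σ ℤ λ v → (ν p (ℕ→ℚ (S n k)) ≡ just v) × ((+ q) ℤ.* v ≡ (+ σ p k) ℤ.- (+ σ p n))

  MaxPole : ℕ → ℕ → Set
  MaxPole m k = Σ ℤ λ v → (ν p (Bneg m k) ≡ just v) × ((+ q) ℤ.* v ≡ ℤ.- (+ σ p m))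

  -- The common form of (i) and (ii) once the factorials are removed: -m/(p-1) is the least
  -- valuation that `powCoef-integral` permits.
  Extremal : ℕ → ℕ → Set
  Extremal k m = Σ ℤ λ v → Val (powCoef k m) v × (+ q ℤ.* v ≡ ℤ.- + m)

  legendreℤ : ∀ n → + q ℤ.* + νℕ p (n !) ℤ.+ + σ p n ≡ + n
  legendreℤ n = trans (cong (ℤ._+ + σ p n) (sym (ℤP.pos-* q (νℕ p (n !))))) (cong +_ (legendre n))

  -- In k! S = n! a, Legendre's formula for k! and n! produces σ(n) - σ(k), which cancels against
  -- (p-1) ν(S) and leaves k - n = -m.
  minZero⇒extremal : ∀ k m → MinZero (k ℕ.+ m) k → Extremal k m
  minZero⇒extremal k m (v , Vv , qv≡) = (b ℤ.+ v) ℤ.- a ,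
    Val-unscale ((k ℕ.+ m) !) (subst (λ x → Val x (b ℤ.+ v)) (k!S≡n!powCoef k m) (Val-scale (k !) Vv)) ,
    (begin
      + q ℤ.* ((b ℤ.+ v) ℤ.- a)
        ≡⟨ expand (+ q) a b v (+ σ p k) ⟩
      (+ q ℤ.* b ℤ.+ + σ p k) ℤ.- (+ q ℤ.* a ℤ.+ (+ σ p k ℤ.- + q ℤ.* v))
        ≡⟨ cong (λ e → (+ q ℤ.* b ℤ.+ + σ p k) ℤ.- (+ q ℤ.* a ℤ.+ (+ σ p k ℤ.- e))) qv≡ ⟩
      (+ q ℤ.* b ℤ.+ + σ p k) ℤ.- (+ q ℤ.* a ℤ.+ (+ σ p k ℤ.- (+ σ p k ℤ.- + σ p (k ℕ.+ m))))
        ≡⟨ simplify (+ q ℤ.* a) (+ q ℤ.* b) (+ σ p k) (+ σ p (k ℕ.+ m)) ⟩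
      (+ q ℤ.* b ℤ.+ + σ p k) ℤ.- (+ q ℤ.* a ℤ.+ + σ p (k ℕ.+ m))
        ≡⟨ cong₂ ℤ._-_ (legendreℤ k) (legendreℤ (k ℕ.+ m)) ⟩
      + k ℤ.- (+ k ℤ.+ + m)
        ≡⟨ cancel (+ k) (+ m) ⟩
      ℤ.- + m ∎)
    where
    open ≡-Reasoning
    instance
      _ = ℕP._!≢0 k
      _ = ℕP._!≢0 (k ℕ.+ m)
    a b : ℤ
    a = + νℕ p ((k ℕ.+ m) !)
    b = + νℕ p (k !)
    expand : ∀ q a b v s → q ℤ.* ((b ℤ.+ v) ℤ.- a) ≡ (q ℤ.* b ℤ.+ s) ℤ.- (q ℤ.* a ℤ.+ (s ℤ.- q ℤ.* v))
    expand = ℤSolver.solve-∀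
    simplify : ∀ a b s t → (b ℤ.+ s) ℤ.- (a ℤ.+ (s ℤ.- (s ℤ.- t))) ≡ (b ℤ.+ s) ℤ.- (a ℤ.+ t)
    simplify = ℤSolver.solve-∀
    cancel : ∀ k m → k ℤ.- (k ℤ.+ m) ≡ ℤ.- m
    cancel = ℤSolver.solve-∀

  Val-S : ∀ k m {v} → Val (powCoef k m) v →
    Val (ℕ→ℚ (S (k ℕ.+ m) k)) ((+ νℕ p ((k ℕ.+ m) !) ℤ.+ v) ℤ.- + νℕ p (k !))
  Val-S k m {v} Vv = Val-unscale (k !) (subst (λ x → Val x (+ νℕ p ((k ℕ.+ m) !) ℤ.+ v))
    (sym (k!S≡n!powCoef k m)) (Val-scale ((k ℕ.+ m) !) Vv))
    where
    instance
      _ = ℕP._!≢0 k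
      _ = ℕP._!≢0 (k ℕ.+ m)

  extremal⇒minZero : ∀ k m → Extremal k m → MinZero (k ℕ.+ m) k
  extremal⇒minZero k m (v , Vv , qv≡) = (a ℤ.+ v) ℤ.- b , Val-S k m Vv ,
    (begin
      + q ℤ.* ((a ℤ.+ v) ℤ.- b)
        ≡⟨ expand (+ q) a b v (+ σ p k) (+ σ p (k ℕ.+ m)) ⟩
      ((+ q ℤ.* a ℤ.+ + σ p (k ℕ.+ m)) ℤ.+ + q ℤ.* v) ℤ.- (+ q ℤ.* b ℤ.+ + σ p k) ℤ.+ (+ σ p k ℤ.- + σ p (k ℕ.+ m))
        ≡⟨ cong (ℤ._+ (+ σ p k ℤ.- + σ p (k ℕ.+ m))) (cong₂ ℤ._-_ (cong₂ ℤ._+_ (legendreℤ (k ℕ.+ m)) qv≡) (legendreℤ k)) ⟩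
      ((+ k ℤ.+ + m) ℤ.+ ℤ.- + m) ℤ.- + k ℤ.+ (+ σ p k ℤ.- + σ p (k ℕ.+ m))
        ≡⟨ cancel (+ k) (+ m) (+ σ p k ℤ.- + σ p (k ℕ.+ m)) ⟩
      + σ p k ℤ.- + σ p (k ℕ.+ m) ∎)
    where
    open ≡-Reasoning
    a b : ℤ
    a = + νℕ p ((k ℕ.+ m) !)
    b = + νℕ p (k !)
    expand : ∀ q a b v s t → q ℤ.* ((a ℤ.+ v) ℤ.- b)
      ≡ ((q ℤ.* a ℤ.+ t) ℤ.+ q ℤ.* v) ℤ.- (q ℤ.* b ℤ.+ s) ℤ.+ (s ℤ.- t)
    expand = ℤSolver.solve-∀
    cancel : ∀ k m s → ((k ℤ.+ m) ℤ.+ ℤ.- m) ℤ.- k ℤ.+ s ≡ s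
    cancel = ℤSolver.solve-∀

  maxPole⇒extremal : ∀ k m → MaxPole m k → Extremal k m
  maxPole⇒extremal k m (v , Vv , qv≡) = v ℤ.- a , Val-unscale (m !) Vv , (begin
    + q ℤ.* (v ℤ.- a)                                  ≡⟨ expand (+ q) a v (+ σ p m) ⟩
    + q ℤ.* v ℤ.+ + σ p m ℤ.- (+ q ℤ.* a ℤ.+ + σ p m)  ≡⟨ cong₂ (λ x y → x ℤ.+ + σ p m ℤ.- y) qv≡ (legendreℤ m) ⟩
    ℤ.- + σ p m ℤ.+ + σ p m ℤ.- + m                    ≡⟨ cancel (+ σ p m) (+ m) ⟩
    ℤ.- + m                                            ∎)
    where
    open ≡-Reasoning
    instance _ = ℕP._!≢0 m
    a : ℤ
    a = + νℕ p (m !)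
    expand : ∀ q a v s → q ℤ.* (v ℤ.- a) ≡ q ℤ.* v ℤ.+ s ℤ.- (q ℤ.* a ℤ.+ s)
    expand = ℤSolver.solve-∀
    cancel : ∀ s m → ℤ.- s ℤ.+ s ℤ.- m ≡ ℤ.- m
    cancel = ℤSolver.solve-∀

  extremal⇒maxPole : ∀ k m → Extremal k m → MaxPole m k
  extremal⇒maxPole k m (v , Vv , qv≡) = a ℤ.+ v , Val-scale (m !) Vv , (begin
    + q ℤ.* (a ℤ.+ v)                                    ≡⟨ expand (+ q) a v (+ σ p m) ⟩
    (+ q ℤ.* a ℤ.+ + σ p m) ℤ.+ + q ℤ.* v ℤ.- + σ p m    ≡⟨ cong₂ (λ x y → x ℤ.+ y ℤ.- + σ p m) (legendreℤ m) qv≡ ⟩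
    + m ℤ.+ ℤ.- + m ℤ.- + σ p m                          ≡⟨ cancel (+ m) (+ σ p m) ⟩
    ℤ.- + σ p m                                          ∎)
    where
    open ≡-Reasoning
    instance _ = ℕP._!≢0 m
    a : ℤ
    a = + νℕ p (m !)
    expand : ∀ q a v s → q ℤ.* (a ℤ.+ v) ≡ (q ℤ.* a ℤ.+ s) ℤ.+ q ℤ.* v ℤ.- s
    expand = ℤSolver.solve-∀
    cancel : ∀ m s → m ℤ.+ ℤ.- m ℤ.- s ≡ ℤ.- s
    cancel = ℤSolver.solve-∀

  -- The integrality of the valuation is what makes p - 1 divide m; the quotient r is its absolute
  -- value.
  q*v≡-m : ∀ v m → + q ℤ.* v ≡ ℤ.- + m → ∃ λ r → v ≡ ℤ.- + r × q ℕ.* r ≡ m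
  q*v≡-m v m eq = ∣ v ∣ , nonPositive v m eq ,
    trans (sym (ℤP.abs-* (+ q) v)) (trans (cong ∣_∣ eq) (ℤP.∣-i∣≡∣i∣ (+ m)))
    where
    nonPositive : ∀ v m → + q ℤ.* v ≡ ℤ.- + m → v ≡ ℤ.- + ∣ v ∣
    nonPositive (+ zero)   m       eq = refl
    nonPositive -[1+ n ]   m       eq = refl
    nonPositive (+ suc n)  zero    ()
    nonPositive (+ suc n)  (suc m) ()

  extremal⇒Val : ∀ k r → Extremal k (q ℕ.* r) → Val (powCoef k (q ℕ.* r)) (ℤ.- + r)
  extremal⇒Val k r (v , Vv , eq) = let s , v≡-s , qs≡qr = q*v≡-m v (q ℕ.* r) eq in
    subst (Val (powCoef k (q ℕ.* r))) (trans v≡-s (cong (λ n → ℤ.- + n) (ℕP.*-cancelˡ-≡ s r q qs≡qr))) Vv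

  -- Valuation -r makes pʳ a a unit, whereas a binomial coefficient divisible by p would force it
  -- into the maximal ideal.
  extremal⇒p∤ : ∀ k r → Extremal k (q ℕ.* r) → ¬ p ∣ ((k ℕ.+ p ℕ.* r) C r)
  extremal⇒p∤ k r ex p∣C = Val0⇒¬Small Vb (subst Small
      (solve 2 (λ b c → (b :+ (:- c)) :+ c := b) refl (P^ r * powCoef k (q ℕ.* r)) (sgn r * ℕ→ℚ ((k ℕ.+ p ℕ.* r) C r)))
      (Small-+ (powCoef-congruence r k) (Small-*ˡ (Integral-ι ((ℤ.- + 1) ℤ.^ r)) (p∣⇒Small p∣C))))
    where
    instance _ = ℕP.m^n≢0 p r
    Vb : Val (P^ r * powCoef k (q ℕ.* r)) (+ 0)
    Vb = trans (Val-scale (p ℕ.^ r) (extremal⇒Val k r ex))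
      (cong just (trans (cong (λ e → + e ℤ.+ ℤ.- + r) (νℕ-^ r)) (ℤP.+-inverseʳ (+ r))))

  p∤⇒extremal : ∀ k r → ¬ p ∣ ((k ℕ.+ p ℕ.* r) C r) → Extremal k (q ℕ.* r)
  p∤⇒extremal k r p∤C = + 0 ℤ.- + νℕ p (p ℕ.^ r) ,
    Val-unscale (p ℕ.^ r) (integral¬Small⇒Val0 Ib ¬Sb) , (begin
      + q ℤ.* (+ 0 ℤ.- + νℕ p (p ℕ.^ r))  ≡⟨ cong (λ e → + q ℤ.* (+ 0 ℤ.- + e)) (νℕ-^ r) ⟩
      + q ℤ.* (+ 0 ℤ.- + r)               ≡⟨ cong (+ q ℤ.*_) (ℤP.+-identityˡ (ℤ.- + r)) ⟩
      + q ℤ.* (ℤ.- + r)                   ≡⟨ ℤP.neg-distribʳ-* (+ q) (+ r) ⟨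
      ℤ.- (+ q ℤ.* + r)                   ≡⟨ cong ℤ.-_ (ℤP.pos-* q r) ⟨
      ℤ.- + (q ℕ.* r)                     ∎)
    where
    open ≡-Reasoning
    instance _ = ℕP.m^n≢0 p r
    b c : ℚ
    b = P^ r * powCoef k (q ℕ.* r)
    c = ℕ→ℚ ((k ℕ.+ p ℕ.* r) C r)
    Ib : Integral b
    Ib = powCoef-integral (q ℕ.* r) (q ℕ.* r) ℕP.≤-refl k r (ℕP.*-monoʳ-< q (ℕP.n<1+n r))
    ¬Sb : ¬ Small b
    -- If b were small, the congruence would make `sgn r * c` small; a second factor `sgn r` removes
    -- the sign.
    ¬Sb Sb = p∤C (Small⇒p∣ (subst Small
      (trans (solve 3 (λ b s c → s :* (b :+ (:- (b :+ (:- (s :* c))))) := s :* s :* c) refl b (sgn r) c)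
        (trans (cong (_* c) (sgn*sgn≡1 r)) (ℚP.*-identityˡ c)))
      (Small-*ˡ (Integral-ι ((ℤ.- + 1) ℤ.^ r)) (Small-+ Sb (Small-neg (powCoef-congruence r k))))))

  -- Unit parts

  factRatio-* : ∀ n k → ℕ→ℚ (k !) * factRatio n k ≡ ℕ→ℚ (n !)
  factRatio-* n k = trans (ℚP.*-comm (ℕ→ℚ (k !)) (factRatio n k)) (/-*-cancel (+ (n !)) (k !))
    where instance _ = ℕP._!≢0 k

  ε-factRatio : ∀ n k → ε p (factRatio n k) * P^ (νℕ p (n !)) ≡ factRatio n k * P^ (νℕ p (k !))
  ε-factRatio n k = ε-Val (factRatio n k) (νℕ p (n !)) (νℕ p (k !))
    (fraction⇒Val (k !) n!≢0 (factRatio-* n k))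
    where
    instance _ = ℕP._!≢0 k
    n!≢0 : + (n !) ≢ + 0
    n!≢0 eq = ℕ.≢-nonZero⁻¹ (n !) {{ℕP._!≢0 n}} (ℤP.+-injective eq)

  -- The unit part is u/w, with u and w the prime-to-p parts of n! and k!. Integrality allows a
  -- congruence to be multiplied by it.
  ε-factRatio-integral : ∀ n k → Integral (ε p (factRatio n k))
  ε-factRatio-integral n k =
    let u , n!≡ , p∤u = νℕ-factorise (n !) {{ℕP._!≢0 n}}
        w , k!≡ , p∤w = νℕ-factorise (k !) {{ℕP._!≢0 k}}
    in integral w (+ u) p∤w (*-cancelˡ (p ℕ.^ νℕ p (n !)) {{ℕP.m^n≢0 p (νℕ p (n !))}} (begin
      A * (ℕ→ℚ w * e)                        ≡⟨ solve 3 (λ A w e → A :* (w :* e) := w :* (e :* A)) refl A (ℕ→ℚ w) e ⟩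
      ℕ→ℚ w * (e * A)                        ≡⟨ cong (ℕ→ℚ w *_) (ε-factRatio n k) ⟩
      ℕ→ℚ w * (R * B)                        ≡⟨ solve 3 (λ w R B → w :* (R :* B) := (B :* w) :* R) refl (ℕ→ℚ w) R B ⟩
      (B * ℕ→ℚ w) * R                        ≡⟨ cong (_* R) (trans (sym (ℕ→ℚ-* (p ℕ.^ νℕ p (k !)) w)) (cong ℕ→ℚ (sym k!≡))) ⟩
      ℕ→ℚ (k !) * R                          ≡⟨ factRatio-* n k ⟩
      ℕ→ℚ (n !)                              ≡⟨ trans (cong ℕ→ℚ n!≡) (ℕ→ℚ-* (p ℕ.^ νℕ p (n !)) u) ⟩
      A * ℕ→ℚ u                              ∎))
    where
    open ≡-Reasoning
    A = P^ (νℕ p (n !))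
    B = P^ (νℕ p (k !))
    R = factRatio n k
    e = ε p R

  ε-cancel : ∀ s R x e f a b r → e * P^ a ≡ s * P^ (b ℕ.+ r) → f * P^ a ≡ R * P^ b → s ≡ R * x → e ≡ f * (P^ r * x)
  ε-cancel s R x e f a b r e≡ f≡ s≡ = *-cancelˡ (p ℕ.^ a) {{ℕP.m^n≢0 p a}} (begin
    P^ a * e                       ≡⟨ ℚP.*-comm (P^ a) e ⟩
    e * P^ a                       ≡⟨ e≡ ⟩
    s * P^ (b ℕ.+ r)               ≡⟨ cong₂ _*_ s≡ (P^-+ b r) ⟩
    (R * x) * (P^ b * P^ r)        ≡⟨ solve 4 (λ R x B Q → (R :* x) :* (B :* Q) := (R :* B) :* (Q :* x)) refl R x (P^ b) (P^ r) ⟩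
    (R * P^ b) * (P^ r * x)        ≡⟨ cong (_* (P^ r * x)) f≡ ⟨
    (f * P^ a) * (P^ r * x)        ≡⟨ solve 3 (λ e A y → (e :* A) :* y := A :* (e :* y)) refl f (P^ a) (P^ r * x) ⟩
    P^ a * (f * (P^ r * x))        ∎)
    where open ≡-Reasoning

  -- Unit parts are multiplicative, S = (n!/k!) a, and pʳ a is the unit part of a since its
  -- valuation is -r.
  ε-S : ∀ k r → Extremal k (q ℕ.* r) → let n = k ℕ.+ q ℕ.* r in
    ε p (ℕ→ℚ (S n k)) ≡ ε p (factRatio n k) * (P^ r * powCoef k (q ℕ.* r))
  ε-S k r ex = ε-cancel s R x (ε p s) (ε p R) a b r (ε-Val s a (b ℕ.+ r) Vs) (ε-factRatio n k) s≡R*x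
    where
    n a b : ℕ
    n = k ℕ.+ q ℕ.* r
    a = νℕ p (n !)
    b = νℕ p (k !)
    s R x : ℚ
    s = ℕ→ℚ (S n k)
    R = factRatio n k
    x = powCoef k (q ℕ.* r)
    regroup : ∀ a b r → (a ℤ.+ ℤ.- r) ℤ.- b ≡ a ℤ.- (b ℤ.+ r)
    regroup = ℤSolver.solve-∀
    Vs : Val s (+ a ℤ.- + (b ℕ.+ r))
    Vs = trans (Val-S k (q ℕ.* r) (extremal⇒Val k r ex)) (cong just (regroup (+ a) (+ b) (+ r)))
    s≡R*x : s ≡ R * x
    s≡R*x = *-cancelˡ (k !) {{ℕP._!≢0 k}} (trans (k!S≡n!powCoef k (q ℕ.* r))
      (trans (cong (_* x) (sym (factRatio-* n k))) (ℚP.*-assoc (ℕ→ℚ (k !)) R x)))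

  Small-congruence-* : ∀ x e b s c → x ≡ e * b → Integral e → Small (b + - (s * c)) → Small (x + - (s * e * c))
  Small-congruence-* x e b s c refl Ie Sb = subst Small
    (solve 4 (λ e b s c → e :* (b :+ (:- (s :* c))) := e :* b :+ (:- (s :* e :* c))) refl e b s c)
    (Small-*ˡ Ie Sb)

  ε-S-congruence : ∀ n N k r → k ℕ.+ q ℕ.* r ≡ n → k ℕ.+ p ℕ.* r ≡ N → Extremal k (q ℕ.* r) →
    ε p (ℕ→ℚ (S n k)) ≡[mod p ] (sgn r * ε p (factRatio n k) * ℕ→ℚ (N C r))
  ε-S-congruence n N k r refl refl ex = Small⇒PosVal
    (Small-congruence-* (ε p (ℕ→ℚ (S n k))) (ε p (factRatio n k)) (P^ r * powCoef k (q ℕ.* r)) (sgn r) (ℕ→ℚ (N C r))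
      (ε-S k r ex) (ε-factRatio-integral n k) (powCoef-congruence r k))

  -- The equivalences and the congruence in terms of n and k

  minZero⇒k≤n : ∀ n k → MinZero n k → k ≤ n
  minZero⇒k≤n n k (v , Vv , _) = ℕP.≮⇒≥ λ n<k →
    Val⇒↥≢0 (ℕ→ℚ (S n k)) Vv (cong (λ s → ↥ ℕ→ℚ s) (n<k⇒S≡0 n k n<k))

  -- For n < k the truncated difference is 0, where the pole condition holds trivially, so k ≤ n has
  -- to accompany it. On the side of S it is automatic, as S(n,k) = 0 has no finite valuation for n
  -- < k.
  minZero⇔maxPole : ∀ n k → MinZero n k ⇔ (k ≤ n × MaxPole (n ∸ k) k)
  minZero⇔maxPole n k = mk⇔
    (λ mz → let k≤n = minZero⇒k≤n n k mz in
      k≤n , extremal⇒maxPole k (n ∸ k) (minZero⇒extremal k (n ∸ k)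
        (subst (λ n → MinZero n k) (sym (ℕP.m+[n∸m]≡n k≤n)) mz)))
    (λ (k≤n , mp) → subst (λ n → MinZero n k) (ℕP.m+[n∸m]≡n k≤n)
      (extremal⇒minZero k (n ∸ k) (maxPole⇒extremal k (n ∸ k) mp)))

  qr+k≡n⇒n+r : ∀ {n k r} → q ℕ.* r ℕ.+ k ≡ n → k ℕ.+ p ℕ.* r ≡ n ℕ.+ r
  qr+k≡n⇒n+r {n} {k} {r} refl = reindex q k r
    where
    reindex : ∀ q k r → k ℕ.+ suc q ℕ.* r ≡ q ℕ.* r ℕ.+ k ℕ.+ r
    reindex = solve-∀

  minZero⇒extremal-r : ∀ {n k r} → q ℕ.* r ℕ.+ k ≡ n → MinZero n k → Extremal k (q ℕ.* r)
  minZero⇒extremal-r {n} {k} {r} eq mz = minZero⇒extremal k (q ℕ.* r)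
    (subst (λ n → MinZero n k) (trans (sym eq) (ℕP.+-comm (q ℕ.* r) k)) mz)

  minZero⇔p∤nCr : ∀ n k → MinZero n k ⇔ (Σ ℕ λ r → (q ℕ.* r ℕ.+ k ≡ n) × ¬ (p ∣ ((n ℕ.+ r) C r)))
  minZero⇔p∤nCr n k = mk⇔ to from
    where
    to : MinZero n k → Σ ℕ λ r → (q ℕ.* r ℕ.+ k ≡ n) × ¬ (p ∣ ((n ℕ.+ r) C r))
    to mz =
      let k≤n = minZero⇒k≤n n k mz
          v , _ , qv≡-m = minZero⇒extremal k (n ∸ k) (subst (λ n → MinZero n k) (sym (ℕP.m+[n∸m]≡n k≤n)) mz)
          r , _ , qr≡m = q*v≡-m v (n ∸ k) qv≡-m
          eq = trans (cong (ℕ._+ k) qr≡m) (ℕP.m∸n+n≡m k≤n)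
      in r , eq , subst (λ N → ¬ p ∣ (N C r)) (qr+k≡n⇒n+r {n} {k} {r} eq)
           (extremal⇒p∤ k r (minZero⇒extremal-r {n} {k} {r} eq mz))
    from : (Σ ℕ λ r → (q ℕ.* r ℕ.+ k ≡ n) × ¬ (p ∣ ((n ℕ.+ r) C r))) → MinZero n k
    from (r , eq , p∤C) = subst (λ n → MinZero n k) (trans (ℕP.+-comm k (q ℕ.* r)) eq)
      (extremal⇒minZero k (q ℕ.* r) (p∤⇒extremal k r
        (subst (λ N → ¬ p ∣ (N C r)) (sym (qr+k≡n⇒n+r {n} {k} {r} eq)) p∤C)))

  minZero⇒ε-congruence : ∀ n k r → q ℕ.* r ℕ.+ k ≡ n → MinZero n k →
    ε p (ℕ→ℚ (S n k)) ≡[mod p ] (sgn r * ε p (factRatio n k) * ℕ→ℚ ((n ℕ.+ r) C r))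
  minZero⇒ε-congruence n k r eq mz = ε-S-congruence n (n ℕ.+ r) k r
    (trans (ℕP.+-comm k (q ℕ.* r)) eq) (qr+k≡n⇒n+r {n} {k} {r} eq) (minZero⇒extremal-r {n} {k} {r} eq mz)

theorem2p1 : (p : ℕ) → Prime p → (n k : ℕ) → 1 ≤ n → 1 ≤ k →
    ((Σ ℤ λ v → (ν p (ℕ→ℚ (S n k)) ≡ just v) × ((+ (p ∸ 1)) ℤ.* v ≡ (+ σ p k) ℤ.- (+ σ p n)))
    ⇔ (k ≤ n × (Σ ℤ λ v → (ν p (Bneg (n ∸ k) k) ≡ just v) × ((+ (p ∸ 1)) ℤ.* v ≡ ℤ.- (+ σ p (n ∸ k))))))
    ×
    ((Σ ℤ λ v → (ν p (ℕ→ℚ (S n k)) ≡ just v) × ((+ (p ∸ 1)) ℤ.* v ≡ (+ σ p k) ℤ.- (+ σ p n)))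
    ⇔ (Σ ℕ λ r → ((p ∸ 1) ℕ.* r ℕ.+ k ≡ n) × ¬ (p ∣ ((n ℕ.+ r) C r))))
    ×
    ((r : ℕ) → (p ∸ 1) ℕ.* r ℕ.+ k ≡ n →
    (Σ ℤ λ v → (ν p (ℕ→ℚ (S n k)) ≡ just v) × ((+ (p ∸ 1)) ℤ.* v ≡ (+ σ p k) ℤ.- (+ σ p n))) →
    ε p (ℕ→ℚ (S n k))
    ≡[mod p ] ((((ℤ.- (+ 1)) ℤ.^ r) ℚ./ 1) ℚ.* ε p (factRatio n k) ℚ.* ℕ→ℚ ((n ℕ.+ r) C r)))
theorem2p1 zero            p-prime = ⊥-elim (¬prime[0] p-prime)
theorem2p1 (suc zero)      p-prime = ⊥-elim (¬prime[1] p-prime)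
theorem2p1 (suc (suc q′)) p-prime n k _ _ =
  minZero⇔maxPole n k , minZero⇔p∤nCr n k , minZero⇒ε-congruence n k
  where open Local q′ p-prime
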